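{- Let $m\ge 2$ and $n\ge 1$ be integers, and let $H(n,m):=K_m^n$ be the Hamming graph. For all nonempty $A\subseteq V(H(n,m))$, $$e_{H(n,m)}(A,A^c)\ge|A|\cdot(m-1)\cdot\bigl(n-\log_m|A|\bigr).$$ Moreover, equality holds whenever $A$ induces a copy of $H(t,m)$ for some $t\in[n]$.
   Context: $[n]$ denotes $\{1,\dots,n\}$. For a graph $G$ and $A\subseteq V(G)$, $A^c=V(G)\setminus A$ and $e_G(A,A^c)$ is the number of edges of $G$ with exactly one endpoint in $A$. $K_m$ is the complete graph on $m$ vertices. $G^n$ denotes the product graph $G\square\cdots\square G$ ($n$ copies): its vertex set is $V(G)^n$ and its edges are all pairs $\{u,v\}$ for which there is an index $j\in[n]$ such that $u_jv_j\in E(G)$ and $u_l=v_l$ for all $l\neq j$. -}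

module Defs where

open import Algebra.Bundles using (CommutativeMonoid)
open import Data.Bool using (Bool; T; T?)
open import Data.Bool.Properties using (T-irrelevant)
open import Data.Empty using (⊥-elim)
open import Data.Fin as Fin using (Fin)
open import Data.Fin.Properties using (any?; all?)
open import Data.Integer as ℤ using (+_)
import Data.Integer.Properties as ℤ
open import Data.List using (List; []; _∷_; length; filter; cartesianProduct; cartesianProductWith; allFin)
open import Data.List.Membership.Propositional using (_∈_)
open import Data.List.Membership.Propositional.Properties
  using (∈-filter⁺; ∈-allFin; ∈-cartesianProductWith⁺; ∈-length)
open import Data.List.Relation.Unary.All as All using (All; []; _∷_)
open import Data.List.Relation.Unary.AllPairs using ([]; _∷_)
open import Data.List.Relation.Unary.Any using (here; there)
open import Data.List.Relation.Unary.Unique.Propositional using (Unique)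
open import Data.List.Relation.Unary.Unique.Propositional.Properties
  using (allFin⁺; cartesianProductWith⁺)
open import Data.Nat as ℕ using (ℕ; zero; suc; _≤_; _<_; z≤n; s≤s; _⊔_)
import Data.Nat.Properties as ℕ
open import Data.Product using (Σ; ∃; _×_; _,_; proj₁; proj₂)
open import Data.Product.Properties using (≡-dec)
open import Data.Rational as ℚ using (ℚ; mkℚ; 0ℚ; 1ℚ; ½)
import Data.Rational.Properties as ℚ
open import Algebra.Properties.CommutativeSemigroup (CommutativeMonoid.commutativeSemigroup ℚ.+-0-commutativeMonoid) using (interchange)
open import Data.Rational.Unnormalised as ℚᵘ using (mkℚᵘ)
import Data.Rational.Unnormalised.Properties as ℚᵘ
open import Data.Sum using (inj₁; inj₂)
open import Data.Vec using (Vec; []; _∷_; lookup)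
import Data.Vec.Properties as Vec
open import Function using (_∘_)
open import Function.Bundles using (_↔_; _⇔_; Inverse)
open import Relation.Binary.Definitions using (Decidable; DecidableEquality; Symmetric)
open import Relation.Binary.PropositionalEquality
  using (_≡_; _≢_; refl; sym; trans; cong; cong₂; subst; subst₂)
open import Relation.Nullary using (¬_; Dec; yes; no)
open import Relation.Nullary.Decidable using (¬?; _×-dec_; _→-dec_)

record Graph : Set₁ where
  infix 4 _~_ _~?_ _≟_
  field
    V        : Set
    _~_      : V → V → Set
    ~-sym    : Symmetric _~_
    ~-irrefl : ∀ {v} → ¬ (v ~ v)
    _≟_      : DecidableEquality V
    _~?_     : Decidable _~_
    vertices : List V
    unique   : Unique vertices
    complete : ∀ v → v ∈ vertices

open Graph using (V; vertices)

Subset : Graph → Set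
Subset G = V G → Bool

Nonempty : (G : Graph) → Subset G → Set
Nonempty G A = ∃ λ v → T (A v)

card : (G : Graph) → Subset G → ℕ
card G A = length (filter (T? ∘ A) (vertices G))

crosses? : (G : Graph) (A : Subset G) (p : V G × V G) →
           Dec (T (A (proj₁ p)) × ¬ T (A (proj₂ p)) × Graph._~_ G (proj₁ p) (proj₂ p))
crosses? G A (u , v) = T? (A u) ×-dec ¬? (T? (A v)) ×-dec Graph._~?_ G u v

-- Every edge with exactly one endpoint in A has exactly one orientation
-- (u , v) with u ∈ A and v ∉ A, so these ordered pairs count each such
-- (unordered) edge once.
boundary : (G : Graph) → Subset G → ℕ
boundary G A = length (filter (crosses? G A) (cartesianProduct (vertices G) (vertices G)))

card>0 : (G : Graph) (A : Subset G) → Nonempty G A → 1 ≤ card G A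
card>0 G A (v , v∈A) = ∈-length (∈-filter⁺ (T? ∘ A) (Graph.complete G v) v∈A)

infix 4 _≅_
record _≅_ (G H : Graph) : Set where
  field
    bijection : V G ↔ V H
    adjacency : ∀ u v → Graph._~_ G u v
                      ⇔ Graph._~_ H (Inverse.to bijection u) (Inverse.to bijection v)

Σ-T-≡ : {X : Set} (A : X → Bool) {p q : Σ X (T ∘ A)} → proj₁ p ≡ proj₁ q → p ≡ q
Σ-T-≡ A {x , a} {.x , b} refl = cong (x ,_) (T-irrelevant a b)

restrict : {X : Set} (A : X → Bool) → List X → List (Σ X (T ∘ A))
restrict A []       = []
restrict A (x ∷ xs) with T? (A x)
... | yes x∈A = (x , x∈A) ∷ restrict A xs
... | no  _   = restrict A xs

restrict-All : {X : Set} (A : X → Bool) {P : X → Set} {xs : List X} →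
               All P xs → All (P ∘ proj₁) (restrict A xs)
restrict-All A []                     = []
restrict-All A (_∷_ {x} px pxs) with T? (A x)
... | yes _ = px ∷ restrict-All A pxs
... | no  _ = restrict-All A pxs

restrict-unique : {X : Set} (A : X → Bool) {xs : List X} →
                  Unique xs → Unique (restrict A xs)
restrict-unique A []                    = []
restrict-unique A (_∷_ {x} x∉xs u) with T? (A x)
... | yes _ = All.map (λ x≢y eq → x≢y (cong proj₁ eq)) (restrict-All A x∉xs)
              ∷ restrict-unique A u
... | no  _ = restrict-unique A u

restrict-complete : {X : Set} (A : X → Bool) {xs : List X} (p : Σ X (T ∘ A)) →
                    proj₁ p ∈ xs → p ∈ restrict A xs
restrict-complete A {x ∷ xs} p x∈xs with T? (A x)
restrict-complete A {x ∷ xs} p (here eq)   | yes x∈A = here (Σ-T-≡ A eq)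
restrict-complete A {x ∷ xs} p (there mem) | yes x∈A = there (restrict-complete A p mem)
restrict-complete A {x ∷ xs} p (here refl) | no x∉A  = ⊥-elim (x∉A (proj₂ p))
restrict-complete A {x ∷ xs} p (there mem) | no x∉A  = restrict-complete A p mem

induced : (G : Graph) → Subset G → Graph
induced G A = record
  { V        = Σ (V G) (T ∘ A)
  ; _~_      = λ p q → proj₁ p ~ proj₁ q
  ; ~-sym    = ~-sym
  ; ~-irrefl = ~-irrefl
  ; _≟_      = ≡-dec _≟_ (λ a b → yes (T-irrelevant a b))
  ; _~?_     = λ p q → proj₁ p ~? proj₁ q
  ; vertices = restrict A (vertices G)
  ; unique   = restrict-unique A unique
  ; complete = λ p → restrict-complete A p (complete (proj₁ p))
  }
  where open Graph G hiding (V; vertices)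

K : ℕ → Graph
K m = record
  { V        = Fin m
  ; _~_      = _≢_
  ; ~-sym    = λ u≢v v≡u → u≢v (sym v≡u)
  ; ~-irrefl = λ v≢v → v≢v refl
  ; _≟_      = Fin._≟_
  ; _~?_     = λ u v → ¬? (u Fin.≟ v)
  ; vertices = allFin m
  ; unique   = allFin⁺ m
  ; complete = ∈-allFin
  }

allVecs : {X : Set} → List X → ∀ n → List (Vec X n)
allVecs xs zero    = [] ∷ []
allVecs xs (suc n) = cartesianProductWith _∷_ xs (allVecs xs n)

allVecs-unique : {X : Set} {xs : List X} → Unique xs → ∀ n → Unique (allVecs xs n)
allVecs-unique u zero    = [] ∷ []
allVecs-unique u (suc n) =
  cartesianProductWith⁺ _∷_ Vec.∷-injective u (allVecs-unique u n)

allVecs-complete : {X : Set} {xs : List X} → (∀ x → x ∈ xs) →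
                   ∀ {n} (v : Vec X n) → v ∈ allVecs xs n
allVecs-complete c []      = here refl
allVecs-complete c (x ∷ v) = ∈-cartesianProductWith⁺ _∷_ (c x) (allVecs-complete c v)

infixr 8 _□^_
_□^_ : Graph → ℕ → Graph
G □^ n = record
  { V        = Vec (V G) n
  ; _~_      = λ u v → ∃ λ j → lookup u j ~ lookup v j
                             × (∀ l → l ≢ j → lookup u l ≡ lookup v l)
  ; ~-sym    = λ (j , uⱼ~vⱼ , rest) → j , ~-sym uⱼ~vⱼ , λ l l≢j → sym (rest l l≢j)
  ; ~-irrefl = λ (j , vⱼ~vⱼ , _) → ~-irrefl vⱼ~vⱼ
  ; _≟_      = Vec.≡-dec _≟_
  ; _~?_     = λ u v → any? λ j → (lookup u j ~? lookup v j)
                 ×-dec all? (λ l → ¬? (l Fin.≟ j) →-dec (lookup u l ≟ lookup v l))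
  ; vertices = allVecs (vertices G) n
  ; unique   = allVecs-unique unique n
  ; complete = allVecs-complete complete
  }
  where open Graph G hiding (V; vertices)

H : ℕ → ℕ → Graph
H n m = K m □^ n

-- Cauchy reals: equality of reals is _≃ᵣ_, not propositional equality.
record ℝ : Set where
  constructor mkℝ
  field
    seq    : ℕ → ℚ
    cauchy : ∀ ε → 0ℚ ℚ.< ε →
             ∃ λ N → ∀ i j → N ≤ i → N ≤ j → ℚ.∣ seq i ℚ.- seq j ∣ ℚ.< ε

open ℝ public using (seq; cauchy)

infix 4 _≃ᵣ_ _≤ᵣ_ _≥ᵣ_

_≃ᵣ_ : ℝ → ℝ → Set
x ≃ᵣ y = ∀ ε → 0ℚ ℚ.< ε → ∃ λ N → ∀ i → N ≤ i → ℚ.∣ seq x i ℚ.- seq y i ∣ ℚ.< ε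

_≤ᵣ_ : ℝ → ℝ → Set
x ≤ᵣ y = ∀ ε → 0ℚ ℚ.< ε → ∃ λ N → ∀ i → N ≤ i → seq x i ℚ.< seq y i ℚ.+ ε

_≥ᵣ_ : ℝ → ℝ → Set
x ≥ᵣ y = y ≤ᵣ x

half>0 : ∀ {ε} → 0ℚ ℚ.< ε → 0ℚ ℚ.< ½ ℚ.* ε
half>0 {ε} 0<ε = subst (ℚ._< ½ ℚ.* ε) (ℚ.*-zeroʳ ½) (ℚ.*-monoʳ-<-pos ½ 0<ε)

half+half : ∀ ε → ½ ℚ.* ε ℚ.+ ½ ℚ.* ε ≡ ε
half+half ε = trans (sym (ℚ.*-distribʳ-+ ε ½ ½)) (ℚ.*-identityˡ ε)

sums : ∀ a b c d → (a ℚ.+ b) ℚ.- (c ℚ.+ d) ≡ (a ℚ.- c) ℚ.+ (b ℚ.- d)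
sums a b c d = trans (cong (a ℚ.+ b ℚ.+_) (ℚ.neg-distrib-+ c d))
                     (interchange a b (ℚ.- c) (ℚ.- d))

negs : ∀ a b → ℚ.- a ℚ.- ℚ.- b ≡ ℚ.- (a ℚ.- b)
negs a b = sym (ℚ.neg-distrib-+ a (ℚ.- b))

cancel : ∀ a b → a ≡ (a ℚ.- b) ℚ.+ b
cancel a b = sym (trans (ℚ.+-assoc a (ℚ.- b) b)
  (trans (cong (a ℚ.+_) (ℚ.+-inverseˡ b)) (ℚ.+-identityʳ a)))

prods : ∀ a b c d → a ℚ.* b ℚ.- c ℚ.* d ≡ a ℚ.* (b ℚ.- d) ℚ.+ d ℚ.* (a ℚ.- c)
prods a b c d = sym (begin-equality
  a ℚ.* (b ℚ.- d) ℚ.+ d ℚ.* (a ℚ.- c)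
    ≡⟨ cong₂ ℚ._+_ (ℚ.*-distribˡ-+ a b (ℚ.- d)) (ℚ.*-distribˡ-+ d a (ℚ.- c)) ⟩
  (a ℚ.* b ℚ.+ a ℚ.* ℚ.- d) ℚ.+ (d ℚ.* a ℚ.+ d ℚ.* ℚ.- c)
    ≡⟨ cong₂ (λ s t → (a ℚ.* b ℚ.+ s) ℚ.+ (d ℚ.* a ℚ.+ t))
             (trans (sym (ℚ.neg-distribʳ-* a d)) (cong ℚ.-_ (ℚ.*-comm a d)))
             (trans (sym (ℚ.neg-distribʳ-* d c)) (cong ℚ.-_ (ℚ.*-comm d c))) ⟩
  (a ℚ.* b ℚ.- d ℚ.* a) ℚ.+ (d ℚ.* a ℚ.- c ℚ.* d)
    ≡⟨ ℚ.+-assoc (a ℚ.* b ℚ.- d ℚ.* a) (d ℚ.* a) (ℚ.- (c ℚ.* d)) ⟨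
  ((a ℚ.* b ℚ.- d ℚ.* a) ℚ.+ d ℚ.* a) ℚ.- c ℚ.* d
    ≡⟨ cong (ℚ._- c ℚ.* d) (sym (cancel (a ℚ.* b) (d ℚ.* a))) ⟩
  a ℚ.* b ℚ.- c ℚ.* d ∎)
  where open ℚ.≤-Reasoning

bounded : (x : ℝ) → ∃ λ B → 0ℚ ℚ.< B × ∃ λ N → ∀ i → N ≤ i → ℚ.∣ seq x i ∣ ℚ.< B
bounded x with cauchy x 1ℚ (ℚ.positive⁻¹ 1ℚ)
... | N , close = B , 0<B , N , λ i N≤i → begin-strict
    ℚ.∣ seq x i ∣                                  ≡⟨ cong ℚ.∣_∣ (cancel (seq x i) (seq x N)) ⟩
    ℚ.∣ (seq x i ℚ.- seq x N) ℚ.+ seq x N ∣        ≤⟨ ℚ.∣p+q∣≤∣p∣+∣q∣ (seq x i ℚ.- seq x N) (seq x N) ⟩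
    ℚ.∣ seq x i ℚ.- seq x N ∣ ℚ.+ ℚ.∣ seq x N ∣    <⟨ ℚ.+-mono-<-≤ (close i N N≤i ℕ.≤-refl) (ℚ.≤-refl {ℚ.∣ seq x N ∣}) ⟩
    B                                              ∎
  where
  open ℚ.≤-Reasoning
  B = 1ℚ ℚ.+ ℚ.∣ seq x N ∣
  0<B : 0ℚ ℚ.< B
  0<B = ℚ.+-mono-<-≤ (ℚ.positive⁻¹ 1ℚ) (ℚ.0≤∣p∣ (seq x N))

shrink : ∀ {B ε} → 0ℚ ℚ.< B → 0ℚ ℚ.< ε → ∃ λ δ → 0ℚ ℚ.< δ × B ℚ.* δ ≡ ε
shrink {B} {ε} 0<B 0<ε = B⁻¹ ℚ.* ε , 0<δ , eq
  where
  instance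
    B-pos : ℚ.Positive B
    B-pos = ℚ.positive 0<B
    B-nz : ℚ.NonZero B
    B-nz = ℚ.pos⇒nonZero B
  B⁻¹ = ℚ.1/ B
  instance
    B⁻¹-pos : ℚ.Positive B⁻¹
    B⁻¹-pos = ℚ.1/pos⇒pos B
  0<δ : 0ℚ ℚ.< B⁻¹ ℚ.* ε
  0<δ = subst (ℚ._< B⁻¹ ℚ.* ε) (ℚ.*-zeroʳ B⁻¹) (ℚ.*-monoʳ-<-pos B⁻¹ 0<ε)
  eq : B ℚ.* (B⁻¹ ℚ.* ε) ≡ ε
  eq = trans (sym (ℚ.*-assoc B B⁻¹ ε))
             (trans (cong (ℚ._* ε) (ℚ.*-inverseʳ B)) (ℚ.*-identityˡ ε))

scaled : ∀ {a b B δ} → 0ℚ ℚ.< B → ℚ.∣ a ∣ ℚ.< B → ℚ.∣ b ∣ ℚ.< δ →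
         ℚ.∣ a ℚ.* b ∣ ℚ.≤ B ℚ.* δ
scaled {a} {b} {B} {δ} 0<B a<B b<δ = begin
  ℚ.∣ a ℚ.* b ∣          ≡⟨ ℚ.∣p*q∣≡∣p∣*∣q∣ a b ⟩
  ℚ.∣ a ∣ ℚ.* ℚ.∣ b ∣    ≤⟨ ℚ.*-monoʳ-≤-nonNeg ℚ.∣ b ∣ {{ℚ.∣-∣-nonNeg b}} (ℚ.<⇒≤ a<B) ⟩
  B ℚ.* ℚ.∣ b ∣          ≤⟨ ℚ.*-monoˡ-≤-nonNeg B {{ℚ.pos⇒nonNeg B {{ℚ.positive 0<B}}}} (ℚ.<⇒≤ b<δ) ⟩
  B ℚ.* δ                ∎
  where open ℚ.≤-Reasoning

fromℕ : ℕ → ℝ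
fromℕ n = mkℝ (λ _ → + n ℚ./ 1) λ ε 0<ε → 0 , λ i j _ _ →
  subst (ℚ._< ε) (sym (cong ℚ.∣_∣ (ℚ.+-inverseʳ (+ n ℚ./ 1)))) 0<ε

infixl 6 _+ᵣ_ _-ᵣ_
infixl 7 _*ᵣ_
infix  8 -ᵣ_

_+ᵣ_ : ℝ → ℝ → ℝ
seq    (x +ᵣ y) i = seq x i ℚ.+ seq y i
cauchy (x +ᵣ y) ε 0<ε
  with cauchy x (½ ℚ.* ε) (half>0 0<ε) | cauchy y (½ ℚ.* ε) (half>0 0<ε)
... | M , f | N , g = M ⊔ N , λ i j p q → begin-strict
    ℚ.∣ (seq x i ℚ.+ seq y i) ℚ.- (seq x j ℚ.+ seq y j) ∣
      ≡⟨ cong ℚ.∣_∣ (sums (seq x i) (seq y i) (seq x j) (seq y j)) ⟩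
    ℚ.∣ (seq x i ℚ.- seq x j) ℚ.+ (seq y i ℚ.- seq y j) ∣
      ≤⟨ ℚ.∣p+q∣≤∣p∣+∣q∣ (seq x i ℚ.- seq x j) (seq y i ℚ.- seq y j) ⟩
    ℚ.∣ seq x i ℚ.- seq x j ∣ ℚ.+ ℚ.∣ seq y i ℚ.- seq y j ∣
      <⟨ ℚ.+-mono-< (f i j (ℕ.m⊔n≤o⇒m≤o M N p) (ℕ.m⊔n≤o⇒m≤o M N q))
                    (g i j (ℕ.m⊔n≤o⇒n≤o M N p) (ℕ.m⊔n≤o⇒n≤o M N q)) ⟩
    ½ ℚ.* ε ℚ.+ ½ ℚ.* ε
      ≡⟨ half+half ε ⟩
    ε ∎
  where open ℚ.≤-Reasoning

-ᵣ_ : ℝ → ℝ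
seq    (-ᵣ x) i = ℚ.- seq x i
cauchy (-ᵣ x) ε 0<ε with cauchy x ε 0<ε
... | N , f = N , λ i j p q → subst (ℚ._< ε)
  (sym (trans (cong ℚ.∣_∣ (negs (seq x i) (seq x j))) (ℚ.∣-p∣≡∣p∣ (seq x i ℚ.- seq x j))))
  (f i j p q)

_-ᵣ_ : ℝ → ℝ → ℝ
x -ᵣ y = x +ᵣ -ᵣ y

_*ᵣ_ : ℝ → ℝ → ℝ
seq    (x *ᵣ y) i = seq x i ℚ.* seq y i
cauchy (x *ᵣ y) ε 0<ε with bounded x | bounded y
... | B , 0<B , M₁ , x<B | C , 0<C , M₂ , y<C
  with shrink 0<B (half>0 (half>0 0<ε)) | shrink 0<C (half>0 0<ε)
... | δ , 0<δ , Bδ | η , 0<η , Cη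
  with cauchy y δ 0<δ | cauchy x η 0<η
... | N₁ , g | N₂ , f = (M₁ ⊔ M₂) ⊔ (N₁ ⊔ N₂) , λ i j p q →
  let pM = ℕ.m⊔n≤o⇒m≤o (M₁ ⊔ M₂) (N₁ ⊔ N₂) p ; pN = ℕ.m⊔n≤o⇒n≤o (M₁ ⊔ M₂) (N₁ ⊔ N₂) p
      qM = ℕ.m⊔n≤o⇒m≤o (M₁ ⊔ M₂) (N₁ ⊔ N₂) q ; qN = ℕ.m⊔n≤o⇒n≤o (M₁ ⊔ M₂) (N₁ ⊔ N₂) q
      a = seq x i ; b = seq y i ; c = seq x j ; d = seq y j
  in begin-strict
    ℚ.∣ a ℚ.* b ℚ.- c ℚ.* d ∣
      ≡⟨ cong ℚ.∣_∣ (prods a b c d) ⟩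
    ℚ.∣ a ℚ.* (b ℚ.- d) ℚ.+ d ℚ.* (a ℚ.- c) ∣
      ≤⟨ ℚ.∣p+q∣≤∣p∣+∣q∣ (a ℚ.* (b ℚ.- d)) (d ℚ.* (a ℚ.- c)) ⟩
    ℚ.∣ a ℚ.* (b ℚ.- d) ∣ ℚ.+ ℚ.∣ d ℚ.* (a ℚ.- c) ∣
      ≤⟨ ℚ.+-mono-≤
           (scaled {a} {b ℚ.- d} 0<B (x<B i (ℕ.m⊔n≤o⇒m≤o M₁ M₂ pM))
             (g i j (ℕ.m⊔n≤o⇒m≤o N₁ N₂ pN) (ℕ.m⊔n≤o⇒m≤o N₁ N₂ qN)))
           (scaled {d} {a ℚ.- c} 0<C (y<C j (ℕ.m⊔n≤o⇒n≤o M₁ M₂ qM))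
             (f i j (ℕ.m⊔n≤o⇒n≤o N₁ N₂ pN) (ℕ.m⊔n≤o⇒n≤o N₁ N₂ qN))) ⟩
    B ℚ.* δ ℚ.+ C ℚ.* η
      ≡⟨ cong₂ ℚ._+_ Bδ Cη ⟩
    ½ ℚ.* (½ ℚ.* ε) ℚ.+ ½ ℚ.* ε
      <⟨ ℚ.+-mono-<-≤ (half< (half>0 0<ε)) (ℚ.≤-refl {½ ℚ.* ε}) ⟩
    ½ ℚ.* ε ℚ.+ ½ ℚ.* ε
      ≡⟨ half+half ε ⟩
    ε ∎
  where
  open ℚ.≤-Reasoning
  half< : ∀ {t} → 0ℚ ℚ.< t → ½ ℚ.* t ℚ.< t
  half< {t} 0<t = begin-strict
    ½ ℚ.* t                  ≡⟨ ℚ.+-identityʳ (½ ℚ.* t) ⟨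
    ½ ℚ.* t ℚ.+ 0ℚ           <⟨ ℚ.+-mono-≤-< (ℚ.≤-refl {½ ℚ.* t}) (half>0 0<t) ⟩
    ½ ℚ.* t ℚ.+ ½ ℚ.* t      ≡⟨ half+half t ⟩
    t                        ∎

-- The largest p ≤ x with b ^ p ≤ y (or 0 if there is none).
searchLog : (b y x : ℕ) → ℕ
searchLog b y zero = zero
searchLog b y (suc x) with b ℕ.^ suc x ℕ.≤? y
... | yes _ = suc x
... | no  _ = searchLog b y x

-- For b ≥ 2 the bound y on the exponent loses nothing, since y < b ^ y.
⌊log⌋ : (b y : ℕ) → ℕ
⌊log⌋ b y = searchLog b y y

⌊log⌋-lower : ∀ b y → 1 ≤ y → b ℕ.^ ⌊log⌋ b y ≤ y
⌊log⌋-lower b y 1≤y = go y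
  where
  go : ∀ x → b ℕ.^ searchLog b y x ≤ y
  go zero = 1≤y
  go (suc x) with b ℕ.^ suc x ℕ.≤? y
  ... | yes le = le
  ... | no  _  = go x

⌊log⌋-upper : ∀ b y → 2 ≤ b → y < b ℕ.^ suc (⌊log⌋ b y)
⌊log⌋-upper b y 2≤b = go y (ℕ.<-trans (n<bⁿ y) (ℕ.^-monoʳ-< b 2≤b (ℕ.n<1+n y)))
  where
  n<bⁿ : ∀ n → n < b ℕ.^ n
  n<bⁿ zero    = s≤s z≤n
  n<bⁿ (suc n) = ℕ.≤-<-trans (n<bⁿ n) (ℕ.^-monoʳ-< b 2≤b (ℕ.n<1+n n))

  go : ∀ x → y < b ℕ.^ suc x → y < b ℕ.^ suc (searchLog b y x)
  go zero y<b = y<b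
  go (suc x) y<b with b ℕ.^ suc x ℕ.≤? y
  ... | yes _ = y<b
  ... | no ¬≤ = go x (ℕ.≰⇒> ¬≤)

frac : ℕ → ℕ → ℚ
frac p k = + p ℚ./ suc k

toℚᵘ-frac : ∀ p k → ℚ.toℚᵘ (frac p k) ℚᵘ.≃ mkℚᵘ (+ p) k
toℚᵘ-frac p k = ℚ.toℚᵘ-fromℚᵘ (mkℚᵘ (+ p) k)

frac-≤ : ∀ p k q l → p ℕ.* suc l ≤ q ℕ.* suc k → frac p k ℚ.≤ frac q l
frac-≤ p k q l h = ℚ.toℚᵘ-cancel-≤
  (ℚᵘ.≤-respˡ-≃ (ℚᵘ.≃-sym (toℚᵘ-frac p k)) (ℚᵘ.≤-respʳ-≃ (ℚᵘ.≃-sym (toℚᵘ-frac q l))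
    (ℚᵘ.*≤* (subst₂ ℤ._≤_ (ℤ.pos-* p (suc l)) (ℤ.pos-* q (suc k)) (ℤ.+≤+ h)))))

frac-< : ∀ p k q l → p ℕ.* suc l < q ℕ.* suc k → frac p k ℚ.< frac q l
frac-< p k q l h = ℚ.toℚᵘ-cancel-<
  (ℚᵘ.<-respˡ-≃ (ℚᵘ.≃-sym (toℚᵘ-frac p k)) (ℚᵘ.<-respʳ-≃ (ℚᵘ.≃-sym (toℚᵘ-frac q l))
    (ℚᵘ.*<* (subst₂ ℤ._<_ (ℤ.pos-* p (suc l)) (ℤ.pos-* q (suc k)) (ℤ.+<+ h)))))

frac-+ : ∀ p q k → frac (p ℕ.+ q) k ≡ frac p k ℚ.+ frac q k
frac-+ p q k = ℚ.toℚᵘ-injective (begin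
  ℚ.toℚᵘ (frac (p ℕ.+ q) k)                  ≈⟨ toℚᵘ-frac (p ℕ.+ q) k ⟩
  mkℚᵘ (+ (p ℕ.+ q)) k                       ≈⟨ ℚᵘ.*≡* eq ⟩
  mkℚᵘ (+ p) k ℚᵘ.+ mkℚᵘ (+ q) k             ≈⟨ ℚᵘ.+-cong (toℚᵘ-frac p k) (toℚᵘ-frac q k) ⟨
  ℚ.toℚᵘ (frac p k) ℚᵘ.+ ℚ.toℚᵘ (frac q k)   ≈⟨ ℚ.toℚᵘ-homo-+ (frac p k) (frac q k) ⟨
  ℚ.toℚᵘ (frac p k ℚ.+ frac q k)             ∎)
  where
  open import Relation.Binary.Reasoning.Setoid ℚᵘ.≃-setoid
  D = + suc k
  eq : + (p ℕ.+ q) ℤ.* (D ℤ.* D) ≡ (+ p ℤ.* D ℤ.+ + q ℤ.* D) ℤ.* D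
  eq = trans (sym (ℤ.*-assoc (+ (p ℕ.+ q)) D D))
             (cong (ℤ._* D) (ℤ.*-distribʳ-+ D (+ p) (+ q)))

frac-* : ∀ n p k → frac (n ℕ.* p) k ≡ (+ n ℚ./ 1) ℚ.* frac p k
frac-* n p k = ℚ.toℚᵘ-injective (begin
  ℚ.toℚᵘ (frac (n ℕ.* p) k)                  ≈⟨ toℚᵘ-frac (n ℕ.* p) k ⟩
  mkℚᵘ (+ (n ℕ.* p)) k                       ≈⟨ ℚᵘ.*≡* eq ⟩
  mkℚᵘ (+ n) 0 ℚᵘ.* mkℚᵘ (+ p) k             ≈⟨ ℚᵘ.*-cong (toℚᵘ-frac n 0) (toℚᵘ-frac p k) ⟨
  ℚ.toℚᵘ (frac n 0) ℚᵘ.* ℚ.toℚᵘ (frac p k)   ≈⟨ ℚ.toℚᵘ-homo-* (frac n 0) (frac p k) ⟨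
  ℚ.toℚᵘ (frac n 0 ℚ.* frac p k)             ∎)
  where
  open import Relation.Binary.Reasoning.Setoid ℚᵘ.≃-setoid
  eq : + (n ℕ.* p) ℤ.* + (1 ℕ.* suc k) ≡ (+ n ℤ.* + p) ℤ.* + suc k
  eq = cong₂ ℤ._*_ (ℤ.pos-* n p) (cong +_ (ℕ.*-identityˡ (suc k)))

archimedean : ∀ q ε → 0ℚ ℚ.< ε → ∃ λ N → ∀ k → N ≤ k → frac q k ℚ.≤ ε
archimedean q ε@(mkℚ (+ suc n) d _) 0<ε = q ℕ.* suc d , λ k N≤k →
  subst (frac q k ℚ.≤_) (ℚ.fromℚᵘ-toℚᵘ ε)
    (frac-≤ q k (suc n) d (ℕ.≤-trans N≤k (ℕ.≤-trans (ℕ.n≤1+n k) (ℕ.m≤n*m (suc k) (suc n)))))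
archimedean q (mkℚ (+ zero) _ _)     (ℚ.*<* (ℤ.+<+ ()))
archimedean q (mkℚ (ℤ.-[1+ _ ]) _ _) (ℚ.*<* ())

∣-∣-< : ∀ a b {ε} → a ℚ.< b ℚ.+ ε → b ℚ.< a ℚ.+ ε → ℚ.∣ a ℚ.- b ∣ ℚ.< ε
∣-∣-< a b {ε} a< b< with ℚ.∣p∣≡p∨∣p∣≡-p (a ℚ.- b)
... | inj₁ eq = subst (ℚ._< ε) (sym eq) (move a b a<)
  where
  move : ∀ a b → a ℚ.< b ℚ.+ ε → a ℚ.- b ℚ.< ε
  move a b h = begin-strict
    a ℚ.- b             <⟨ ℚ.+-mono-<-≤ h (ℚ.≤-refl {ℚ.- b}) ⟩
    (b ℚ.+ ε) ℚ.- b     ≡⟨ cong (ℚ._- b) (ℚ.+-comm b ε) ⟩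
    (ε ℚ.+ b) ℚ.- b     ≡⟨ ℚ.+-assoc ε b (ℚ.- b) ⟩
    ε ℚ.+ (b ℚ.- b)     ≡⟨ cong (ε ℚ.+_) (ℚ.+-inverseʳ b) ⟩
    ε ℚ.+ 0ℚ            ≡⟨ ℚ.+-identityʳ ε ⟩
    ε                   ∎
    where open ℚ.≤-Reasoning
... | inj₂ eq = begin-strict
    ℚ.∣ a ℚ.- b ∣       ≡⟨ eq ⟩
    ℚ.- (a ℚ.- b)       ≡⟨ ℚ.neg-distrib-+ a (ℚ.- b) ⟩
    ℚ.- a ℚ.- ℚ.- b     <⟨ ℚ.+-mono-≤-< (ℚ.≤-refl {ℚ.- a}) (ℚ.≤-<-trans (ℚ.≤-reflexive (neg-neg b)) b<) ⟩
    ℚ.- a ℚ.+ (a ℚ.+ ε) ≡⟨ ℚ.+-assoc (ℚ.- a) a ε ⟨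
    (ℚ.- a ℚ.+ a) ℚ.+ ε ≡⟨ cong (ℚ._+ ε) (ℚ.+-inverseˡ a) ⟩
    0ℚ ℚ.+ ε            ≡⟨ ℚ.+-identityˡ ε ⟩
    ε                   ∎
  where
  open ℚ.≤-Reasoning
  neg-neg : ∀ p → ℚ.- (ℚ.- p) ≡ p
  neg-neg (mkℚ (+ zero) _ _)     = refl
  neg-neg (mkℚ (+ suc _) _ _)    = refl
  neg-neg (mkℚ (ℤ.-[1+ _ ]) _ _) = refl

exp-< : ∀ b p q → 2 ≤ b → b ℕ.^ p < b ℕ.^ q → p < q
exp-< b@(suc _) p q 2≤b h = ℕ.≰⇒> λ q≤p → ℕ.<⇒≱ h (ℕ.^-monoʳ-≤ b q≤p)

exp-≤ : ∀ b p q → 2 ≤ b → b ℕ.^ p ≤ b ℕ.^ q → p ≤ q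
exp-≤ b p q 2≤b h = ℕ.≮⇒≥ λ q<p → ℕ.<⇒≱ (ℕ.^-monoʳ-< b 2≤b q<p) h

pow>0 : ∀ {a} n → 1 ≤ a → 1 ≤ a ℕ.^ n
pow>0 {suc a} n _ = ℕ.m^n>0 (suc a) n

pow-comm : ∀ a m n → (a ℕ.^ m) ℕ.^ n ≡ (a ℕ.^ n) ℕ.^ m
pow-comm a m n = trans (ℕ.^-*-assoc a m n)
  (trans (cong (a ℕ.^_) (ℕ.*-comm m n)) (sym (ℕ.^-*-assoc a n m)))

module _ {b a : ℕ} (2≤b : 2 ≤ b) (1≤a : 1 ≤ a) where

  fl : ℕ → ℕ
  fl i = ⌊log⌋ b (a ℕ.^ suc i)

  -- If b ^ p ≤ a ^ q then p / q < (fl j + 1) / (j + 1).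
  fl-above : ∀ p q → 1 ≤ q → b ℕ.^ p ≤ a ℕ.^ q →
             ∀ j → p ℕ.* suc j < suc (fl j) ℕ.* q
  fl-above p (suc q) _ h j = exp-< b _ _ 2≤b (begin-strict
    b ℕ.^ (p ℕ.* suc j)              ≡⟨ ℕ.^-*-assoc b p (suc j) ⟨
    (b ℕ.^ p) ℕ.^ suc j              ≤⟨ ℕ.^-monoˡ-≤ (suc j) h ⟩
    (a ℕ.^ suc q) ℕ.^ suc j          ≡⟨ pow-comm a (suc q) (suc j) ⟩
    (a ℕ.^ suc j) ℕ.^ suc q          <⟨ ℕ.^-monoˡ-< (suc q) (⌊log⌋-upper b (a ℕ.^ suc j) 2≤b) ⟩
    (b ℕ.^ suc (fl j)) ℕ.^ suc q     ≡⟨ ℕ.^-*-assoc b (suc (fl j)) (suc q) ⟩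
    b ℕ.^ (suc (fl j) ℕ.* suc q)     ∎)
    where open ℕ.≤-Reasoning

  -- If a ^ q ≤ b ^ p then fl j / (j + 1) ≤ p / q.
  fl-below : ∀ p q → a ℕ.^ q ≤ b ℕ.^ p → ∀ j → fl j ℕ.* q ≤ p ℕ.* suc j
  fl-below p q h j = exp-≤ b _ _ 2≤b (begin
    b ℕ.^ (fl j ℕ.* q)          ≡⟨ ℕ.^-*-assoc b (fl j) q ⟨
    (b ℕ.^ fl j) ℕ.^ q          ≤⟨ ℕ.^-monoˡ-≤ q (⌊log⌋-lower b (a ℕ.^ suc j) (pow>0 (suc j) 1≤a)) ⟩
    (a ℕ.^ suc j) ℕ.^ q         ≡⟨ pow-comm a (suc j) q ⟩
    (a ℕ.^ q) ℕ.^ suc j         ≤⟨ ℕ.^-monoˡ-≤ (suc j) h ⟩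
    (b ℕ.^ p) ℕ.^ suc j         ≡⟨ ℕ.^-*-assoc b p (suc j) ⟩
    b ℕ.^ (p ℕ.* suc j)         ∎)
    where open ℕ.≤-Reasoning

  fl-close : ∀ i j {ε} → frac 1 j ℚ.≤ ε → frac (fl i) i ℚ.< frac (fl j) j ℚ.+ ε
  fl-close i j {ε} small = begin-strict
    frac (fl i) i                  <⟨ frac-< (fl i) i (suc (fl j)) j
                                        (fl-above (fl i) (suc i) (s≤s z≤n)
                                          (⌊log⌋-lower b (a ℕ.^ suc i) (pow>0 (suc i) 1≤a)) j) ⟩
    frac (suc (fl j)) j            ≡⟨ cong (λ n → frac n j) (ℕ.+-comm 1 (fl j)) ⟩
    frac (fl j ℕ.+ 1) j            ≡⟨ frac-+ (fl j) 1 j ⟩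
    frac (fl j) j ℚ.+ frac 1 j     ≤⟨ ℚ.+-mono-≤ (ℚ.≤-refl {frac (fl j) j}) small ⟩
    frac (fl j) j ℚ.+ ε            ∎
    where open ℚ.≤-Reasoning

-- With k = i + 1, the i-th approximation is ⌊log_b (a ^ k)⌋ / k, which lies
-- in (log_b a - 1/k , log_b a].
log : (b a : ℕ) → 2 ≤ b → 1 ≤ a → ℝ
seq    (log b a 2≤b 1≤a) i = + ⌊log⌋ b (a ℕ.^ suc i) ℚ./ suc i
cauchy (log b a 2≤b 1≤a) ε 0<ε with archimedean 1 ε 0<ε
... | N , small = N , λ i j N≤i N≤j →
  ∣-∣-< (frac (fl 2≤b 1≤a i) i) (frac (fl 2≤b 1≤a j) j)
    (fl-close 2≤b 1≤a i j (small j N≤j)) (fl-close 2≤b 1≤a j i (small i N≤i))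

-- The next two facts pin down log b a among the reals: p ≤ q · log_b a
-- whenever b ^ p ≤ a ^ q, and q · log_b a ≤ p whenever a ^ q ≤ b ^ p.
log-lower : ∀ {b a} (2≤b : 2 ≤ b) (1≤a : 1 ≤ a) p q →
            b ℕ.^ p ≤ a ℕ.^ q → fromℕ p ≤ᵣ fromℕ q *ᵣ log b a 2≤b 1≤a
log-lower {b} {a} 2≤b 1≤a p q h ε 0<ε with archimedean (suc q) ε 0<ε
... | N , small = N , λ j N≤j → let f = fl 2≤b 1≤a j in begin-strict
    frac p 0                                        <⟨ frac-< p 0 (q ℕ.* f ℕ.+ suc q) j (bound q h j) ⟩
    frac (q ℕ.* f ℕ.+ suc q) j                      ≡⟨ frac-+ (q ℕ.* f) (suc q) j ⟩
    frac (q ℕ.* f) j ℚ.+ frac (suc q) j             ≡⟨ cong (ℚ._+ frac (suc q) j) (frac-* q f j) ⟩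
    frac q 0 ℚ.* frac f j ℚ.+ frac (suc q) j        ≤⟨ ℚ.+-mono-≤ (ℚ.≤-refl {frac q 0 ℚ.* frac f j}) (small j N≤j) ⟩
    frac q 0 ℚ.* frac f j ℚ.+ ε                     ∎
  where
  open ℚ.≤-Reasoning
  bound : ∀ q → b ℕ.^ p ≤ a ℕ.^ q → ∀ j →
          p ℕ.* suc j < (q ℕ.* fl 2≤b 1≤a j ℕ.+ suc q) ℕ.* 1
  bound zero    h j rewrite ℕ.n≤0⇒n≡0 (exp-≤ b p 0 2≤b h) = s≤s z≤n
  bound (suc q) h j = ℕ.<-≤-trans (fl-above 2≤b 1≤a p (suc q) (s≤s z≤n) h j)
    (ℕ.≤-trans (ℕ.≤-reflexive (trans (ℕ.*-comm (suc f) (suc q)) (trans (ℕ.*-suc (suc q) f) (ℕ.+-comm (suc q) _))))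
      (ℕ.≤-trans (ℕ.+-monoʳ-≤ (suc q ℕ.* f) (ℕ.n≤1+n (suc q))) (ℕ.≤-reflexive (sym (ℕ.*-identityʳ _)))))
    where f = fl 2≤b 1≤a j

log-upper : ∀ {b a} (2≤b : 2 ≤ b) (1≤a : 1 ≤ a) p q →
            a ℕ.^ q ≤ b ℕ.^ p → fromℕ q *ᵣ log b a 2≤b 1≤a ≤ᵣ fromℕ p
log-upper {b} {a} 2≤b 1≤a p q h ε 0<ε = 0 , λ j _ → let f = fl 2≤b 1≤a j in begin-strict
    frac q 0 ℚ.* frac f j     ≡⟨ frac-* q f j ⟨
    frac (q ℕ.* f) j          ≤⟨ frac-≤ (q ℕ.* f) j p 0
                                   (subst (_≤ p ℕ.* suc j)
                                     (trans (ℕ.*-comm f q) (sym (ℕ.*-identityʳ (q ℕ.* f))))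
                                     (fl-below 2≤b 1≤a p q h j)) ⟩
    frac p 0                  ≡⟨ ℚ.+-identityʳ (frac p 0) ⟨
    frac p 0 ℚ.+ 0ℚ           <⟨ ℚ.+-mono-≤-< (ℚ.≤-refl {frac p 0}) 0<ε ⟩
    frac p 0 ℚ.+ ε            ∎
  where open ℚ.≤-Reasoning

{-# OPTIONS --safe #-}
module Submission where

-- The count ν of coordinates off which two vertices agree is 1 on edges, n on the diagonal and 0
-- elsewhere, and ∑ᵥ ν u v = n m for every u. Hence e(A, Aᶜ) + ∑_{u,v ∈ A} ν u v = |A| n m, and the
-- inequality amounts to m ^ (∑_{u,v ∈ A} ν u v) ≤ m ^ (n |A|) * |A| ^ (|A| (m - 1)). Slicing A by
-- its first coordinate into pieces of sizes aₓ, induction on n reduces this to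
--   ∑_{x,y} min (aₓ, a_y) log m + (m - 1) ∑ₓ aₓ log aₓ ≤ a log m + (m - 1) a log a,  a = ∑ₓ aₓ.
-- The entropy a log a - ∑ₓ aₓ log aₓ is superadditive (log-sum inequality, from AM-GM), while the sum
-- of minima is additive along the decomposition of (aₓ) into indicators of nested supports; on the
-- indicator of a k-set the inequality is m ^ (k - 1) ≤ k ^ (m - 1), i.e. concavity of log.

open import Data.Nat using (ℕ; _≤_)
open import Data.Product using (_×_)
open import Defs

open import Algebra.Properties.CommutativeSemigroup using (interchange)
open import Data.Bool using (Bool; true; false; T; T?; not; _∧_)
open import Data.Empty using (⊥-elim)
open import Data.Fin as Fin using (Fin; zero; suc)
import Data.Fin.Properties as Fin
open import Data.List using (List; []; _∷_; _++_; length; map; replicate; filter; allFin; cartesianProduct; cartesianProductWith)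
open import Data.List.Membership.Propositional using (_∈_)
open import Data.List.Membership.Propositional.Properties using (∈-map⁺)
open import Data.List.Membership.Propositional.Properties.WithK using (unique∧set⇒bag)
open import Data.List.Properties using (length-++; length-replicate; length-tabulate; map-cong; map-∘; map-++)
open import Data.List.Relation.Binary.BagAndSetEquality using (∼bag⇒↭)
open import Data.List.Relation.Binary.Permutation.Propositional using (_↭_)
import Data.List.Relation.Binary.Permutation.Propositional.Properties as ↭
open import Data.List.Relation.Unary.All as All using (All; []; _∷_)
open import Data.List.Relation.Unary.AllPairs using ([]; _∷_)
open import Data.List.Relation.Unary.Any using (here; there)
open import Data.List.Relation.Unary.Unique.Propositional using (Unique)
import Data.List.Relation.Unary.Unique.Propositional.Properties as Unique
open import Data.Nat hiding (ℕ; _≤_)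
open import Data.Nat.ListAction using (sum; product)
open import Data.Nat.ListAction.Properties using (sum-++; product-++; sum-↭)
open import Data.Nat.Properties
open import Data.Nat.Tactic.RingSolver using (solve-∀)
open import Data.Product using (_,_; proj₁)
import Data.Rational as ℚ
import Data.Rational.Properties as ℚ
open import Data.Rational.Solver using (module +-*-Solver)
open import Data.Sum using (inj₁; inj₂)
open import Data.Vec using (Vec; []; _∷_; lookup)
import Data.Vec.Properties as Vec
open import Function using (_∘_)
open import Function.Bundles using (_↔_; _⇔_; Inverse; Equivalence; mk⇔)
open import Relation.Binary.Definitions using (DecidableEquality)
open import Relation.Binary.PropositionalEquality
open import Relation.Nullary using (¬_; Dec; yes; no; does)

-- Arithmetic-geometric mean and log-sum inequalities

^-distribʳ-* : ∀ m n k → (m * n) ^ k ≡ m ^ k * n ^ k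
^-distribʳ-* m n zero    = refl
^-distribʳ-* m n (suc k) = trans (cong (m * n *_) (^-distribʳ-* m n k))
                                 ([m*n]*[o*p]≡[m*o]*[n*p] m n (m ^ k) (n ^ k))

-- As `0 ^ 0` is 1, the power `n ^ n` encodes n log n with the convention 0 log 0 = 0, and it can be
-- cancelled even at zero.
n^n≢0 : ∀ n → NonZero (n ^ n)
n^n≢0 zero    = _
n^n≢0 (suc n) = m^n≢0 (suc n) (suc n)

-- Writing the larger number as the smaller one plus d, the two sides differ by `d * d`; subtraction
-- in ℕ is thus avoided.
2mn≤m²+n² : ∀ m n → 2 * (m * n) ≤ m * m + n * n
2mn≤m²+n² m n with ≤-total m n
... | inj₁ m≤n = subst (λ n → 2 * (m * n) ≤ m * m + n * n) (m+[n∸m]≡n m≤n)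
  (≤-trans (m≤m+n _ ((n ∸ m) * (n ∸ m))) (≤-reflexive (eq m (n ∸ m))))
  where
  eq : ∀ m d → 2 * (m * (m + d)) + d * d ≡ m * m + (m + d) * (m + d)
  eq = solve-∀
... | inj₂ n≤m = subst (λ m → 2 * (m * n) ≤ m * m + n * n) (m+[n∸m]≡n n≤m)
  (≤-trans (m≤m+n _ ((m ∸ n) * (m ∸ n))) (≤-reflexive (eq n (m ∸ n))))
  where
  eq : ∀ n d → 2 * ((n + d) * n) + d * d ≡ (n + d) * (n + d) + n * n
  eq = solve-∀

-- The curve t ↦ t ^ (k + 1) lies above its tangent at s, with the negative terms moved across. The
-- induction step adds t times the inequality for k to a multiple of 2ts ≤ t² + s².
young : ∀ s t k → suc k * (t * s ^ k) ≤ t ^ suc k + k * s ^ suc k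
young s t zero    = ≤-reflexive (eq t)
  where
  eq : ∀ t → 1 * (t * 1) ≡ t * 1 + 0
  eq = solve-∀
-- The summand added to both sides turns the coefficient k + 2 into 2 (k + 1), which fits 2ts; on
-- the right it comes back out of the induction hypothesis.
young s t (suc k) = +-cancelʳ-≤ (k * (t * (s * X))) _ _ (begin
  suc (suc k) * (t * (s * X)) + k * (t * (s * X))   ≡⟨ eq₁ k t s X ⟩
  suc k * X * (2 * (t * s))                         ≤⟨ *-monoʳ-≤ (suc k * X) (2mn≤m²+n² t s) ⟩
  suc k * X * (t * t + s * s)                       ≡⟨ eq₂ k t s X ⟩
  t * (suc k * (t * X)) + suc k * (s * (s * X))     ≤⟨ +-monoˡ-≤ _ (*-monoʳ-≤ t (young s t k)) ⟩
  t * (t * Y + k * (s * X)) + suc k * (s * (s * X)) ≡⟨ eq₃ k t s X Y ⟩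
  t * (t * Y) + suc k * (s * (s * X)) + k * (t * (s * X)) ∎)
  where
  open ≤-Reasoning
  X = s ^ k
  Y = t ^ k
  eq₁ : ∀ k t s X → suc (suc k) * (t * (s * X)) + k * (t * (s * X)) ≡ suc k * X * (2 * (t * s))
  eq₁ = solve-∀
  eq₂ : ∀ k t s X → suc k * X * (t * t + s * s) ≡ t * (suc k * (t * X)) + suc k * (s * (s * X))
  eq₂ = solve-∀
  eq₃ : ∀ k t s X Y → t * (t * Y + k * (s * X)) + suc k * (s * (s * X))
                    ≡ t * (t * Y) + suc k * (s * (s * X)) + k * (t * (s * X))
  eq₃ = solve-∀

-- Young's inequality at s = (k + 1) S and t = k (S + y).
amgm-step : ∀ k S y → suc k ^ suc k * (S ^ k * y) ≤ k ^ k * (S + y) ^ suc k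
-- The general case cancels a factor `k`, so k = 0 is separate; it says y ≤ S + y.
amgm-step zero S y = ≤-trans (m≤n+m _ S) (≤-reflexive (eq S y))
  where
  eq : ∀ S y → S + 1 * (1 * y) ≡ 1 * ((S + y) * 1)
  eq = solve-∀
amgm-step k@(suc _) S y = *-cancelˡ-≤ k (+-cancelʳ-≤ (k * v ^ suc k) _ _ (begin
  k * (suc k ^ suc k * (S ^ k * y)) + k * v ^ suc k
    ≡⟨ cong (λ z → k * (suc k ^ suc k * (S ^ k * y)) + k * (v * z)) (^-distribʳ-* (suc k) S k) ⟩
  k * (suc k ^ suc k * (S ^ k * y)) + k * (v * (suc k ^ k * S ^ k))
    ≡⟨ eq k S y (suc k ^ k) (S ^ k) ⟩
  suc k * (u * (suc k ^ k * S ^ k))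
    ≡⟨ cong (λ z → suc k * (u * z)) (^-distribʳ-* (suc k) S k) ⟨
  suc k * (u * v ^ k)
    ≤⟨ young v u k ⟩
  u ^ suc k + k * v ^ suc k
    ≡⟨ cong (_+ k * v ^ suc k) (trans (^-distribʳ-* k (S + y) (suc k)) (*-assoc k (k ^ k) _)) ⟩
  k * (k ^ k * (S + y) ^ suc k) + k * v ^ suc k ∎))
  where
  open ≤-Reasoning
  u = k * (S + y)
  v = suc k * S
  eq : ∀ k S y A B → k * (suc k * A * (B * y)) + k * (suc k * S * (A * B))
                   ≡ suc k * (k * (S + y) * (A * B))
  eq = solve-∀

-- The mean inequality with roots and denominators cleared. After multiplication by `k ^ k` the
-- induction hypothesis replaces the product of the tail by a power of its sum, and `amgm-step`
-- takes in the new entry.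
amgm : ∀ xs → length xs ^ length xs * product xs ≤ sum xs ^ length xs
amgm []       = ≤-refl
amgm (y ∷ xs) = *-cancelˡ-≤ (k ^ k) {{n^n≢0 k}} (begin
  k ^ k * (suc k ^ suc k * (y * product xs)) ≡⟨ eq (k ^ k) (suc k ^ suc k) y (product xs) ⟩
  suc k ^ suc k * (k ^ k * product xs * y)   ≤⟨ *-monoʳ-≤ (suc k ^ suc k) (*-monoˡ-≤ y (amgm xs)) ⟩
  suc k ^ suc k * (sum xs ^ k * y)           ≤⟨ amgm-step k (sum xs) y ⟩
  k ^ k * (sum xs + y) ^ suc k               ≡⟨ cong (λ z → k ^ k * z ^ suc k) (+-comm (sum xs) y) ⟩
  k ^ k * (y + sum xs) ^ suc k               ∎)
  where
  open ≤-Reasoning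
  k = length xs
  eq : ∀ K L y P → K * (L * (y * P)) ≡ L * (K * P * y)
  eq = solve-∀

sum-replicate : ∀ n x → sum (replicate n x) ≡ n * x
sum-replicate zero    x = refl
sum-replicate (suc n) x = cong (x +_) (sum-replicate n x)

product-replicate : ∀ n x → product (replicate n x) ≡ x ^ n
product-replicate zero    x = refl
product-replicate (suc n) x = cong (x *_) (product-replicate n x)

weighted-amgm : ∀ p q x y → (p + q) ^ (p + q) * (x ^ p * y ^ q) ≤ (p * x + q * y) ^ (p + q)
weighted-amgm p q x y = subst₂ _≤_
  (cong₂ (λ k P → k ^ k * P) len
    (trans (product-++ xs ys) (cong₂ _*_ (product-replicate p x) (product-replicate q y))))
  (cong₂ _^_ (trans (sum-++ xs ys) (cong₂ _+_ (sum-replicate p x) (sum-replicate q y))) len)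
  (amgm (xs ++ ys))
  where
  xs = replicate p x
  ys = replicate q y
  len : length (xs ++ ys) ≡ p + q
  len = trans (length-++ xs) (cong₂ _+_ (length-replicate p) (length-replicate q))

-- Weighted AM-GM for x / p and y / q with weights p and q. Scaling both by `p * q` gives the
-- integers `q * x` and `p * y`, whose weighted sum is `p * q * (x + y)`.
log-sum : ∀ p q x y → (p + q) ^ (p + q) * (x ^ p * y ^ q) ≤ (x + y) ^ (p + q) * (p ^ p * q ^ q)
-- When p or q is zero, the factor cancelled in the general case may vanish; monotonicity of powers
-- in the base suffices there.
log-sum zero q x y = begin
  q ^ q * (1 * y ^ q)         ≤⟨ *-monoʳ-≤ (q ^ q) (*-monoʳ-≤ 1 (^-monoˡ-≤ q (m≤n+m y x))) ⟩
  q ^ q * (1 * (x + y) ^ q)   ≡⟨ eq (q ^ q) ((x + y) ^ q) ⟩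
  (x + y) ^ q * (1 * q ^ q)   ∎
  where
  open ≤-Reasoning
  eq : ∀ a b → a * (1 * b) ≡ b * (1 * a)
  eq = solve-∀
log-sum p@(suc _) zero x y = begin
  (p + 0) ^ (p + 0) * (x ^ p * 1)         ≡⟨ cong (λ z → z ^ z * (x ^ p * 1)) (+-identityʳ p) ⟩
  p ^ p * (x ^ p * 1)                     ≤⟨ *-monoʳ-≤ (p ^ p) (*-monoˡ-≤ 1 (^-monoˡ-≤ p (m≤m+n x y))) ⟩
  p ^ p * ((x + y) ^ p * 1)               ≡⟨ eq (p ^ p) ((x + y) ^ p) ⟩
  (x + y) ^ p * (p ^ p * 1)               ≡⟨ cong (λ z → (x + y) ^ z * (p ^ p * 1)) (+-identityʳ p) ⟨
  (x + y) ^ (p + 0) * (p ^ p * 1)         ∎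
  where
  open ≤-Reasoning
  eq : ∀ a b → a * (b * 1) ≡ b * (a * 1)
  eq = solve-∀
log-sum p@(suc _) q@(suc _) x y = *-cancelˡ-≤ (q ^ p * p ^ q) {{m*n≢0 (q ^ p) (p ^ q) {{m^n≢0 q p}} {{m^n≢0 p q}}}} (begin
  q ^ p * p ^ q * (N * (x ^ p * y ^ q))      ≡⟨ eq₁ (q ^ p) (p ^ q) N (x ^ p) (y ^ q) ⟩
  N * (q ^ p * x ^ p * (p ^ q * y ^ q))      ≡⟨ cong (N *_) (cong₂ _*_ (^-distribʳ-* q x p) (^-distribʳ-* p y q)) ⟨
  N * ((q * x) ^ p * (p * y) ^ q)            ≤⟨ weighted-amgm p q (q * x) (p * y) ⟩
  (p * (q * x) + q * (p * y)) ^ (p + q)      ≡⟨ cong (_^ (p + q)) (eq₂ p q x y) ⟩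
  (p * q * (x + y)) ^ (p + q)                ≡⟨ ^-distribʳ-* (p * q) (x + y) (p + q) ⟩
  (p * q) ^ (p + q) * Z                      ≡⟨ cong (_* Z) (^-distribʳ-* p q (p + q)) ⟩
  p ^ (p + q) * q ^ (p + q) * Z              ≡⟨ cong (_* Z) (cong₂ _*_ (^-distribˡ-+-* p p q) (^-distribˡ-+-* q p q)) ⟩
  p ^ p * p ^ q * (q ^ p * q ^ q) * Z        ≡⟨ eq₃ (p ^ p) (p ^ q) (q ^ p) (q ^ q) Z ⟩
  q ^ p * p ^ q * (Z * (p ^ p * q ^ q))      ∎)
  where
  open ≤-Reasoning
  N = (p + q) ^ (p + q)
  Z = (x + y) ^ (p + q)
  eq₁ : ∀ a b N c d → a * b * (N * (c * d)) ≡ N * (a * c * (b * d))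
  eq₁ = solve-∀
  eq₂ : ∀ p q x y → p * (q * x) + q * (p * y) ≡ p * q * (x + y)
  eq₂ = solve-∀
  eq₃ : ∀ a b c d Z → a * b * (c * d) * Z ≡ c * b * (Z * (a * d))
  eq₃ = solve-∀

-- Finite sums and products

∑ : {X : Set} → List X → (X → ℕ) → ℕ
∑ xs f = sum (map f xs)

∏ : {X : Set} → List X → (X → ℕ) → ℕ
∏ xs f = product (map f xs)

module _ {X : Set} where

  ∑-cong : ∀ (xs : List X) {f g} → (∀ x → f x ≡ g x) → ∑ xs f ≡ ∑ xs g
  ∑-cong xs f≗g = cong sum (map-cong f≗g xs)

  ∑-mono : ∀ (xs : List X) {f g} → (∀ x → f x ≤ g x) → ∑ xs f ≤ ∑ xs g
  ∑-mono []       f≤g = z≤n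
  ∑-mono (x ∷ xs) f≤g = +-mono-≤ (f≤g x) (∑-mono xs f≤g)

  ∑-const : ∀ (xs : List X) c → ∑ xs (λ _ → c) ≡ length xs * c
  ∑-const []       c = refl
  ∑-const (x ∷ xs) c = cong (c +_) (∑-const xs c)

  ∑-zero : ∀ (xs : List X) → ∑ xs (λ _ → 0) ≡ 0
  ∑-zero xs = trans (∑-const xs 0) (*-zeroʳ (length xs))

  ∑-+ : ∀ (xs : List X) f g → ∑ xs (λ x → f x + g x) ≡ ∑ xs f + ∑ xs g
  ∑-+ []       f g = refl
  ∑-+ (x ∷ xs) f g = trans (cong (f x + g x +_) (∑-+ xs f g)) (interchange +-commutativeSemigroup (f x) (g x) _ _)

  ∑-*ˡ : ∀ (xs : List X) c f → ∑ xs (λ x → c * f x) ≡ c * ∑ xs f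
  ∑-*ˡ []       c f = sym (*-zeroʳ c)
  ∑-*ˡ (x ∷ xs) c f = trans (cong (c * f x +_) (∑-*ˡ xs c f)) (sym (*-distribˡ-+ c (f x) _))

  ∑-*ʳ : ∀ (xs : List X) f c → ∑ xs (λ x → f x * c) ≡ ∑ xs f * c
  ∑-*ʳ []       f c = refl
  ∑-*ʳ (x ∷ xs) f c = trans (cong (f x * c +_) (∑-*ʳ xs f c)) (sym (*-distribʳ-+ c (f x) _))

  ∑-++ : ∀ (xs ys : List X) f → ∑ (xs ++ ys) f ≡ ∑ xs f + ∑ ys f
  ∑-++ xs ys f = trans (cong sum (map-++ f xs ys)) (sum-++ (map f xs) (map f ys))

∑-swap : ∀ {X Y : Set} (xs : List X) (ys : List Y) (f : X → Y → ℕ) →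
         ∑ xs (λ x → ∑ ys (f x)) ≡ ∑ ys (λ y → ∑ xs (λ x → f x y))
∑-swap []       ys f = sym (∑-zero ys)
∑-swap (x ∷ xs) ys f = trans (cong (∑ ys (f x) +_) (∑-swap xs ys f)) (sym (∑-+ ys (f x) _))

∑-cartesianProductWith : ∀ {X Y Z : Set} (h : X → Y → Z) xs ys (f : Z → ℕ) →
  ∑ (cartesianProductWith h xs ys) f ≡ ∑ xs (λ x → ∑ ys (λ y → f (h x y)))
∑-cartesianProductWith h []       ys f = refl
∑-cartesianProductWith h (x ∷ xs) ys f = trans (∑-++ (map (h x) ys) _ f)
  (cong₂ _+_ (cong sum (sym (map-∘ ys))) (∑-cartesianProductWith h xs ys f))

∏-cong : ∀ {X : Set} (xs : List X) {f g : X → ℕ} → (∀ x → f x ≡ g x) → ∏ xs f ≡ ∏ xs g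
∏-cong xs f≗g = cong product (map-cong f≗g xs)

∏-one : ∀ {X : Set} (xs : List X) {f : X → ℕ} → (∀ x → f x ≡ 1) → ∏ xs f ≡ 1
∏-one []       f≡1 = refl
∏-one (x ∷ xs) f≡1 = cong₂ _*_ (f≡1 x) (∏-one xs f≡1)

∏-mono : ∀ {X : Set} (xs : List X) {f g : X → ℕ} → (∀ x → f x ≤ g x) → ∏ xs f ≤ ∏ xs g
∏-mono []       f≤g = ≤-refl
∏-mono (x ∷ xs) f≤g = *-mono-≤ (f≤g x) (∏-mono xs f≤g)

∏-* : ∀ {X : Set} (xs : List X) (f g : X → ℕ) → ∏ xs (λ x → f x * g x) ≡ ∏ xs f * ∏ xs g
∏-* []       f g = refl
∏-* (x ∷ xs) f g = trans (cong (f x * g x *_) (∏-* xs f g)) ([m*n]*[o*p]≡[m*o]*[n*p] (f x) (g x) _ _)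

∏-^ : ∀ {X : Set} (xs : List X) (f : X → ℕ) k → ∏ xs (λ x → f x ^ k) ≡ ∏ xs f ^ k
∏-^ []       f k = sym (^-zeroˡ k)
∏-^ (x ∷ xs) f k = trans (cong (f x ^ k *_) (∏-^ xs f k)) (sym (^-distribʳ-* (f x) _ k))

^-∏ : ∀ {X : Set} (xs : List X) b (f : X → ℕ) → b ^ ∑ xs f ≡ ∏ xs (λ x → b ^ f x)
^-∏ []       b f = refl
^-∏ (x ∷ xs) b f = trans (^-distribˡ-+-* b (f x) (∑ xs f)) (cong (b ^ f x *_) (^-∏ xs b f))

∑-≤1 : ∀ {X : Set} (xs : List X) {f : X → ℕ} → (∀ x → f x ≤ 1) → ∑ xs f ≤ length xs
∑-≤1 xs f≤1 = ≤-trans (∑-mono xs f≤1) (≤-reflexive (trans (∑-const xs 1) (*-identityʳ _)))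

-- Entropy and sums of pairwise minima

-- The product of the instances of `log-sum` along the list. S and T stay arbitrary so that the
-- induction leaves them fixed; they become the totals of a and b only afterwards.
log-sum-∏ : ∀ {X : Set} (xs : List X) (a b : X → ℕ) S T →
  ∏ xs (λ x → (a x + b x) ^ (a x + b x)) * (S ^ ∑ xs a * T ^ ∑ xs b)
  ≤ (S + T) ^ ∑ xs (λ x → a x + b x) * (∏ xs (λ x → a x ^ a x) * ∏ xs (λ x → b x ^ b x))
log-sum-∏ []       a b S T = ≤-refl
log-sum-∏ (x ∷ xs) a b S T = begin
  (p + q) ^ (p + q) * P * (S ^ (p + A) * T ^ (q + B))
    ≡⟨ cong (λ z → (p + q) ^ (p + q) * P * z) (cong₂ _*_ (^-distribˡ-+-* S p A) (^-distribˡ-+-* T q B)) ⟩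
  (p + q) ^ (p + q) * P * (S ^ p * S ^ A * (T ^ q * T ^ B))
    ≡⟨ eq₁ ((p + q) ^ (p + q)) P (S ^ p) (S ^ A) (T ^ q) (T ^ B) ⟩
  (p + q) ^ (p + q) * (S ^ p * T ^ q) * (P * (S ^ A * T ^ B))
    ≤⟨ *-mono-≤ (log-sum p q S T) (log-sum-∏ xs a b S T) ⟩
  (S + T) ^ (p + q) * (p ^ p * q ^ q) * ((S + T) ^ AB * (Q * R))
    ≡⟨ eq₂ ((S + T) ^ (p + q)) (p ^ p) (q ^ q) ((S + T) ^ AB) Q R ⟩
  (S + T) ^ (p + q) * (S + T) ^ AB * (p ^ p * Q * (q ^ q * R))
    ≡⟨ cong (_* (p ^ p * Q * (q ^ q * R))) (^-distribˡ-+-* (S + T) (p + q) AB) ⟨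
  (S + T) ^ (p + q + AB) * (p ^ p * Q * (q ^ q * R)) ∎
  where
  open ≤-Reasoning
  p = a x
  q = b x
  A = ∑ xs a
  B = ∑ xs b
  AB = ∑ xs (λ x → a x + b x)
  P = ∏ xs (λ x → (a x + b x) ^ (a x + b x))
  Q = ∏ xs (λ x → a x ^ a x)
  R = ∏ xs (λ x → b x ^ b x)
  eq₁ : ∀ N P c d e f → N * P * (c * d * (e * f)) ≡ N * (c * e) * (P * (d * f))
  eq₁ = solve-∀
  eq₂ : ∀ N c d M Q R → N * (c * d) * (M * (Q * R)) ≡ N * M * (c * Q * (d * R))
  eq₂ = solve-∀

-- Superadditivity of the homogeneous entropy S log S - ∑ aᵢ log aᵢ (S = ∑ aᵢ), exponentiated.
entropy-superadditive : ∀ {X : Set} (xs : List X) (a b : X → ℕ) →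
  let A = ∑ xs a; B = ∑ xs b in
  ∏ xs (λ x → (a x + b x) ^ (a x + b x)) * (A ^ A * B ^ B)
  ≤ (A + B) ^ (A + B) * (∏ xs (λ x → a x ^ a x) * ∏ xs (λ x → b x ^ b x))
entropy-superadditive xs a b =
  subst (λ z → ∏ xs (λ x → (a x + b x) ^ (a x + b x)) * (∑ xs a ^ ∑ xs a * ∑ xs b ^ ∑ xs b)
             ≤ (∑ xs a + ∑ xs b) ^ z * (∏ xs (λ x → a x ^ a x) * ∏ xs (λ x → b x ^ b x))) (∑-+ xs a b)
    (log-sum-∏ xs a b (∑ xs a) (∑ xs b))

-- Concavity of log: log k lies above the chord from (1, 0) to (m + 1, log (m + 1)), times k.
support-bound : ∀ m k → k ≤ suc m → suc m ^ (k * k) ≤ suc m ^ k * (k ^ k) ^ m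
support-bound m zero    _ = ≤-reflexive (sym (trans (*-identityˡ (1 ^ m)) (^-zeroˡ m)))
support-bound m k@(suc j) (s≤s j≤m) = begin
  suc m ^ (k + j * k)          ≡⟨ ^-distribˡ-+-* (suc m) k (j * k) ⟩
  suc m ^ k * suc m ^ (j * k)  ≡⟨ cong (suc m ^ k *_) (^-*-assoc (suc m) j k) ⟨
  suc m ^ k * (suc m ^ j) ^ k  ≤⟨ *-monoʳ-≤ (suc m ^ k) (^-monoˡ-≤ k chord) ⟩
  suc m ^ k * (k ^ m) ^ k      ≡⟨ cong (suc m ^ k *_) (pow-comm k m k) ⟩
  suc m ^ k * (k ^ k) ^ m      ∎
  where
  open ≤-Reasoning
  -- Here i stands for m - j. The mean of i copies of 1 and j copies of i + j + 1 is exactly j + 1 =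
  -- k.
  chord′ : ∀ i → suc (i + j) ^ j ≤ k ^ (i + j)
  chord′ i = *-cancelˡ-≤ ((i + j) ^ (i + j)) {{n^n≢0 (i + j)}} (begin
    (i + j) ^ (i + j) * suc (i + j) ^ j          ≡⟨ cong ((i + j) ^ (i + j) *_) (trans (cong (_* suc (i + j) ^ j) (^-zeroˡ i)) (*-identityˡ _)) ⟨
    (i + j) ^ (i + j) * (1 ^ i * suc (i + j) ^ j) ≤⟨ weighted-amgm i j 1 (suc (i + j)) ⟩
    (i * 1 + j * suc (i + j)) ^ (i + j)          ≡⟨ cong (_^ (i + j)) (eq i j) ⟩
    ((i + j) * k) ^ (i + j)                      ≡⟨ ^-distribʳ-* (i + j) k (i + j) ⟩
    (i + j) ^ (i + j) * k ^ (i + j)              ∎)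
    where
    eq : ∀ i j → i * 1 + j * suc (i + j) ≡ (i + j) * suc j
    eq = solve-∀
  chord : suc m ^ j ≤ k ^ m
  chord = subst (λ m → suc m ^ j ≤ k ^ m) (m∸n+n≡m j≤m) (chord′ (m ∸ j))

-- For slice sizes `a x` this bounds the number of pairs in the set with equal tails, as the slices
-- at x and y share at most `a x ⊓ a y` tails. The pairs with x = y are included.
min-sum : {X : Set} → List X → (X → ℕ) → ℕ
min-sum xs a = ∑ xs λ x → ∑ xs λ y → a x ⊓ a y

∑-product : ∀ {X : Set} (xs : List X) (f : X → ℕ) → ∑ xs (λ x → ∑ xs λ y → f x * f y) ≡ ∑ xs f * ∑ xs f
∑-product xs f = trans (∑-cong xs λ x → ∑-*ˡ xs (f x) f) (∑-*ʳ xs f (∑ xs f))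

-- Induction on N: subtracting the indicator of the support of a, of size k, lowers the sum of
-- minima by k * k, and superadditivity compares the entropies.
min-sum-bound : ∀ {X : Set} (xs : List X) m → length xs ≤ suc m →
  ∀ N (a : X → ℕ) → (∀ x → a x ≤ N) →
  suc m ^ min-sum xs a * ∏ xs (λ x → a x ^ a x) ^ m ≤ suc m ^ ∑ xs a * (∑ xs a ^ ∑ xs a) ^ m
min-sum-bound xs m len zero a a≤0 = ≤-reflexive
  (cong₂ _*_ (cong (suc m ^_) M≡S) (cong (_^ m) (trans P≡1 (sym (cong (λ z → z ^ z) S≡0)))))
  where
  a≡0 : ∀ x → a x ≡ 0
  a≡0 x = n≤0⇒n≡0 (a≤0 x)
  S≡0 : ∑ xs a ≡ 0
  S≡0 = trans (∑-cong xs a≡0) (∑-zero xs)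
  M≡S : min-sum xs a ≡ ∑ xs a
  M≡S = trans (trans (∑-cong xs λ x → trans (∑-cong xs λ y → cong (_⊓ a y) (a≡0 x)) (∑-zero xs)) (∑-zero xs)) (sym S≡0)
  P≡1 : ∏ xs (λ x → a x ^ a x) ≡ 1
  P≡1 = ∏-one xs λ x → cong (λ z → z ^ z) (a≡0 x)
min-sum-bound {X} xs m len (suc N) a a≤N =
  -- This is the factor that accompanies `P` in the superadditivity estimate `P≤`, raised to the
  -- power m.
  *-cancelʳ-≤ _ _ ((S' ^ S' * k ^ k) ^ m) {{m^n≢0 _ m {{m*n≢0 _ _ {{n^n≢0 S'}} {{n^n≢0 k}}}}}} (begin
  suc m ^ min-sum xs a * P ^ m * (S' ^ S' * k ^ k) ^ m
    ≡⟨ cong (λ z → z * P ^ m * (S' ^ S' * k ^ k) ^ m)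
         (trans (cong (suc m ^_) M≡) (^-distribˡ-+-* (suc m) M' (k * k))) ⟩
  suc m ^ M' * suc m ^ (k * k) * P ^ m * (S' ^ S' * k ^ k) ^ m
    ≡⟨ trans (*-assoc (suc m ^ M' * suc m ^ (k * k)) (P ^ m) _)
         (cong (suc m ^ M' * suc m ^ (k * k) *_) (sym (^-distribʳ-* P (S' ^ S' * k ^ k) m))) ⟩
  suc m ^ M' * suc m ^ (k * k) * (P * (S' ^ S' * k ^ k)) ^ m
    ≤⟨ *-mono-≤ (*-monoʳ-≤ (suc m ^ M') (support-bound m k k≤)) (^-monoˡ-≤ m P≤) ⟩
  suc m ^ M' * (suc m ^ k * (k ^ k) ^ m) * (S ^ S * P') ^ m
    ≡⟨ cong (suc m ^ M' * (suc m ^ k * (k ^ k) ^ m) *_) (^-distribʳ-* (S ^ S) P' m) ⟩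
  suc m ^ M' * (suc m ^ k * (k ^ k) ^ m) * ((S ^ S) ^ m * P' ^ m)
    ≡⟨ eq₁ (suc m ^ M') (suc m ^ k) ((k ^ k) ^ m) ((S ^ S) ^ m) (P' ^ m) ⟩
  suc m ^ M' * P' ^ m * (suc m ^ k * (k ^ k) ^ m * (S ^ S) ^ m)
    ≤⟨ *-monoˡ-≤ _ (min-sum-bound xs m len N a' (λ x → pred-mono-≤ (a≤N x))) ⟩
  suc m ^ S' * (S' ^ S') ^ m * (suc m ^ k * (k ^ k) ^ m * (S ^ S) ^ m)
    ≡⟨ eq₂ (suc m ^ S') ((S' ^ S') ^ m) (suc m ^ k) ((k ^ k) ^ m) ((S ^ S) ^ m) ⟩
  suc m ^ S' * suc m ^ k * (S ^ S) ^ m * ((S' ^ S') ^ m * (k ^ k) ^ m)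
    ≡⟨ cong₂ (λ y z → y * (S ^ S) ^ m * z) (^-distribˡ-+-* (suc m) S' k) (^-distribʳ-* (S' ^ S') (k ^ k) m) ⟨
  suc m ^ (S' + k) * (S ^ S) ^ m * (S' ^ S' * k ^ k) ^ m
    ≡⟨ cong (λ z → suc m ^ z * (S ^ S) ^ m * (S' ^ S' * k ^ k) ^ m) S≡ ⟨
  suc m ^ S * (S ^ S) ^ m * (S' ^ S' * k ^ k) ^ m ∎)
  where
  open ≤-Reasoning
  a' s : X → ℕ
  a' x = pred (a x)
  s x = a x ⊓ 1
  a≡ : ∀ x → a x ≡ a' x + s x
  a≡ x = split (a x)
    where
    split : ∀ n → n ≡ pred n + n ⊓ 1
    split zero    = refl
    split (suc n) = trans (+-comm 1 n) (cong (λ z → n + suc z) (sym (⊓-zeroʳ n)))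
  S = ∑ xs a
  S' = ∑ xs a'
  k = ∑ xs s
  M' = min-sum xs a'
  P = ∏ xs (λ x → a x ^ a x)
  P' = ∏ xs (λ x → a' x ^ a' x)
  S≡ : S ≡ S' + k
  S≡ = trans (∑-cong xs a≡) (∑-+ xs a' s)
  k≤ : k ≤ suc m
  k≤ = ≤-trans (∑-≤1 xs λ x → m⊓n≤n (a x) 1) len
  M≡ : min-sum xs a ≡ M' + k * k
  M≡ = trans (∑-cong xs λ x → trans (∑-cong xs λ y → split (a x) (a y)) (∑-+ xs _ _))
         (trans (∑-+ xs _ _) (cong (M' +_) (∑-product xs s)))
    where
    -- The minimum counts the levels that both m and n reach; the product of indicators is the
    -- lowest level.
    split : ∀ m n → m ⊓ n ≡ pred m ⊓ pred n + (m ⊓ 1) * (n ⊓ 1)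
    split zero    n       = refl
    split (suc m) zero    = sym (cong₂ _+_ (⊓-zeroʳ m) (*-zeroʳ (suc m ⊓ 1)))
    split (suc m) (suc n) rewrite ⊓-zeroʳ m | ⊓-zeroʳ n = +-comm 1 (m ⊓ n)
  P≤ : P * (S' ^ S' * k ^ k) ≤ S ^ S * P'
  P≤ = begin
    P * (S' ^ S' * k ^ k)             ≡⟨ cong (_* (S' ^ S' * k ^ k)) (∏-cong xs λ x → cong (λ z → z ^ z) (a≡ x)) ⟩
    ∏ xs (λ x → (a' x + s x) ^ (a' x + s x)) * (S' ^ S' * k ^ k)
                                      ≤⟨ entropy-superadditive xs a' s ⟩
    (S' + k) ^ (S' + k) * (P' * ∏ xs (λ x → s x ^ s x))
                                      ≡⟨ cong₂ (λ y z → y ^ y * (P' * z)) (sym S≡) (∏-one xs (λ x → 0/1 (a x))) ⟩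
    S ^ S * (P' * 1)                  ≡⟨ cong (S ^ S *_) (*-identityʳ P') ⟩
    S ^ S * P'                        ∎
    where
    -- The values of `s` are 0 and 1, both with z ^ z = 1, so the indicator leaves no factor of its
    -- own.
    0/1 : ∀ n → (n ⊓ 1) ^ (n ⊓ 1) ≡ 1
    0/1 zero    = refl
    0/1 (suc n) = cong (λ z → suc z ^ suc z) (⊓-zeroʳ n)
  eq₁ : ∀ a b c d e → a * (b * c) * (d * e) ≡ a * e * (b * c * d)
  eq₁ = solve-∀
  eq₂ : ∀ a b c d e → a * b * (c * d * e) ≡ a * c * e * (b * d)
  eq₂ = solve-∀

-- Counting in Hamming graphs

bit : Bool → ℕ
bit true  = 1
bit false = 0

ind : {P : Set} → Dec P → ℕ
ind P? = bit (does P?)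

bit≤1 : ∀ b → bit b ≤ 1
bit≤1 true  = ≤-refl
bit≤1 false = z≤n

bit-T : ∀ {b} → T b → bit b ≡ 1
bit-T {true} _ = refl

bit-¬T : ∀ {b} → ¬ T b → bit b ≡ 0
bit-¬T {true}  ¬t = ⊥-elim (¬t _)
bit-¬T {false} _  = refl

bit-∧ : ∀ a b → bit (a ∧ b) ≡ bit a * bit b
bit-∧ true  b = sym (+-identityʳ (bit b))
bit-∧ false b = refl

bit-idem : ∀ b → bit b * bit b ≡ bit b
bit-idem true  = refl
bit-idem false = refl

bit-not-+ : ∀ b → bit (not b) + bit b ≡ 1
bit-not-+ true  = refl
bit-not-+ false = refl

bit-not-* : ∀ b → bit b * bit (not b) ≡ 0
bit-not-* true  = refl
bit-not-* false = refl

ind-yes : {P : Set} (P? : Dec P) → P → ind P? ≡ 1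
ind-yes (yes _) _ = refl
ind-yes (no ¬p) p = ⊥-elim (¬p p)

ind-no : {P : Set} (P? : Dec P) → ¬ P → ind P? ≡ 0
ind-no (yes p) ¬p = ⊥-elim (¬p p)
ind-no (no _)  _  = refl

length-filter-∑ : {X : Set} {P : X → Set} (P? : ∀ x → Dec (P x)) (xs : List X) →
                  length (filter P? xs) ≡ ∑ xs (λ x → ind (P? x))
length-filter-∑ P? []       = refl
length-filter-∑ P? (x ∷ xs) with does (P? x)
... | true  = cong suc (length-filter-∑ P? xs)
... | false = length-filter-∑ P? xs

∑-delta : {X : Set} (_≟_ : DecidableEquality X) {xs : List X} → Unique xs →
          ∀ {x} → x ∈ xs → (f : X → ℕ) → ∑ xs (λ y → ind (x ≟ y) * f y) ≡ f x
∑-delta {X} _≟_ {x ∷ xs} (x∉xs ∷ _) (here refl) f = trans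
  (cong₂ _+_ (trans (cong (_* f x) (ind-yes (x ≟ x) refl)) (*-identityˡ (f x))) (off x∉xs))
  (+-identityʳ (f x))
  where
  off : ∀ {ys} → All (x ≢_) ys → ∑ ys (λ y → ind (x ≟ y) * f y) ≡ 0
  off []                 = refl
  off (_∷_ {y} x≢y x∉ys) = cong₂ _+_ (cong (_* f y) (ind-no (x ≟ y) x≢y)) (off x∉ys)
∑-delta _≟_ {x ∷ xs} (x∉xs ∷ u) {z} (there z∈xs) f =
  cong₂ _+_ (cong (_* f x) (ind-no (z ≟ x) λ z≡x → All.lookup x∉xs z∈xs (sym z≡x))) (∑-delta _≟_ u z∈xs f)

∑-delta-vertices : ∀ G v f → ∑ (Graph.vertices G) (λ w → ind (Graph._≟_ G v w) * f w) ≡ f v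
∑-delta-vertices G v f = ∑-delta (Graph._≟_ G) (Graph.unique G) (Graph.complete G v) f

∑∑ : (G : Graph) → (Graph.V G → Graph.V G → ℕ) → ℕ
∑∑ G f = ∑ (Graph.vertices G) λ u → ∑ (Graph.vertices G) λ v → f u v

∑∑-cong : ∀ G {f g : Graph.V G → Graph.V G → ℕ} → (∀ u v → f u v ≡ g u v) → ∑∑ G f ≡ ∑∑ G g
∑∑-cong G eq = ∑-cong (Graph.vertices G) λ u → ∑-cong (Graph.vertices G) (eq u)

∑∑-+ : ∀ G f g → ∑∑ G (λ u v → f u v + g u v) ≡ ∑∑ G f + ∑∑ G g
∑∑-+ G f g = trans (∑-cong (Graph.vertices G) λ u → ∑-+ (Graph.vertices G) (f u) (g u))
                   (∑-+ (Graph.vertices G) _ _)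

card-∑ : ∀ G A → card G A ≡ ∑ (Graph.vertices G) (bit ∘ A)
card-∑ G A = length-filter-∑ (T? ∘ A) (Graph.vertices G)

boundary-∑∑ : ∀ G A → boundary G A
            ≡ ∑∑ G (λ u v → bit (A u) * bit (not (A v)) * ind (Graph._~?_ G u v))
boundary-∑∑ G A = trans (length-filter-∑ (crosses? G A) (cartesianProduct vs vs))
  (trans (∑-cartesianProductWith _,_ vs vs _)
    (∑∑-cong G λ u v → trans (bit-∧ (A u) _)
      (trans (cong (bit (A u) *_) (bit-∧ (not (A v)) _)) (sym (*-assoc (bit (A u)) _ _)))))
  where vs = Graph.vertices G

module _ {m : ℕ} where

  δ : ∀ {n} → Vec (Fin m) n → Vec (Fin m) n → ℕ
  δ {n} u v = ind (Graph._≟_ (H n m) u v)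

  -- The number of coordinates off which u and v agree: 1 on edges, n on the diagonal, else 0.
  ν : ∀ {n} → Vec (Fin m) n → Vec (Fin m) n → ℕ
  ν []      []      = 0
  ν (x ∷ u) (y ∷ v) = δ u v + ind (x Fin.≟ y) * ν u v

  lookup-ext : ∀ {n} {u v : Vec (Fin m) n} → (∀ i → lookup u i ≡ lookup v i) → u ≡ v
  lookup-ext {u = u} {v} eq = trans (sym (Vec.tabulate∘lookup u))
    (trans (Vec.tabulate-cong eq) (Vec.tabulate∘lookup v))

  δ-refl : ∀ {n} (u : Vec (Fin m) n) → δ u u ≡ 1
  δ-refl {n} u = ind-yes (Graph._≟_ (H n m) u u) refl

  δ-≢ : ∀ {n} (u v : Vec (Fin m) n) → u ≢ v → δ u v ≡ 0
  δ-≢ {n} u v = ind-no (Graph._≟_ (H n m) u v)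

  ν-refl : ∀ {n} (u : Vec (Fin m) n) → ν u u ≡ n
  ν-refl []      = refl
  ν-refl (x ∷ u) = cong₂ _+_ (δ-refl u)
    (trans (cong₂ _*_ (ind-yes (x Fin.≟ x) refl) (ν-refl u)) (*-identityˡ _))

  ν-adjacent : ∀ {n} (u v : Vec (Fin m) n) → Graph._~_ (H n m) u v → ν u v ≡ 1
  ν-adjacent (x ∷ u) (y ∷ v) (zero , x≢y , rest) = cong₂ _+_
    (trans (cong (δ u) (sym (lookup-ext λ l → rest (suc l) λ ()))) (δ-refl u))
    (cong (_* ν u v) (ind-no (x Fin.≟ y) x≢y))
  ν-adjacent (x ∷ u) (y ∷ v) (suc j , uⱼ≢vⱼ , rest) = cong₂ _+_
    (δ-≢ u v λ u≡v → uⱼ≢vⱼ (cong (λ w → lookup w j) u≡v))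
    (cong₂ _*_ (ind-yes (x Fin.≟ y) (rest zero λ ()))
      (ν-adjacent u v (j , uⱼ≢vⱼ , λ l l≢j → rest (suc l) (l≢j ∘ Fin.suc-injective))))

  -- With equal heads, an edge or equality between the tails would extend to the whole vectors. With
  -- different heads, equal tails would make an edge in the first coordinate.
  ν-nonadjacent : ∀ {n} (u v : Vec (Fin m) n) → u ≢ v → ¬ Graph._~_ (H n m) u v → ν u v ≡ 0
  ν-nonadjacent []      []      u≢v _ = ⊥-elim (u≢v refl)
  ν-nonadjacent (x ∷ u) (y ∷ v) u≢v u≁v with x Fin.≟ y
  ... | yes refl = cong₂ _+_ (δ-≢ u v (u≢v ∘ cong (x ∷_)))
    (trans (*-identityˡ (ν u v)) (ν-nonadjacent u v (u≢v ∘ cong (x ∷_)) λ (j , uⱼ≢vⱼ , rest) →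
      u≁v (suc j , uⱼ≢vⱼ , λ { zero _ → refl ; (suc l) ne → rest l (ne ∘ cong suc) })))
  ... | no x≢y = trans (+-identityʳ (δ u v)) (δ-≢ u v λ { refl →
      u≁v (zero , x≢y , λ { zero ne → ⊥-elim (ne refl) ; (suc l) _ → refl }) })

  -- As a matrix, `ν` is the adjacency matrix plus n times the identity. The recursive form of `ν`
  -- serves induction on n, this one serves edge counting.
  ν-split : ∀ {n} (u v : Vec (Fin m) n) → ν u v ≡ ind (Graph._~?_ (H n m) u v) + n * δ u v
  ν-split {n} u v = split (Graph._≟_ (H n m) u v) (Graph._~?_ (H n m) u v)
    where
    open ≡-Reasoning
    u~?v = Graph._~?_ (H n m) u v
    split : Dec (u ≡ v) → Dec (Graph._~_ (H n m) u v) → ν u v ≡ ind u~?v + n * δ u v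
    split (yes refl) _ = trans (ν-refl u) (sym (cong₂ _+_
      (ind-no u~?v (Graph.~-irrefl (H n m) {u})) (trans (cong (n *_) (δ-refl u)) (*-identityʳ n))))
    split (no u≢v) (yes u~v) = trans (ν-adjacent u v u~v) (sym (cong₂ _+_
      (ind-yes u~?v u~v) (trans (cong (n *_) (δ-≢ u v u≢v)) (*-zeroʳ n))))
    split (no u≢v) (no u≁v) = trans (ν-nonadjacent u v u≢v u≁v) (sym (cong₂ _+_
      (ind-no u~?v u≁v) (trans (cong (n *_) (δ-≢ u v u≢v)) (*-zeroʳ n))))

  vecs : ∀ n → List (Vec (Fin m) n)
  vecs n = Graph.vertices (H n m)

  ∑-vecs : ∀ n f → ∑ (vecs (suc n)) f ≡ ∑ (allFin m) (λ x → ∑ (vecs n) λ u → f (x ∷ u))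
  ∑-vecs n f = ∑-cartesianProductWith _∷_ (allFin m) (vecs n) f

  ∑-δ : ∀ {n} (u : Vec (Fin m) n) f → ∑ (vecs n) (λ v → δ u v * f v) ≡ f u
  ∑-δ {n} = ∑-delta-vertices (H n m)

  length-allFin : length (allFin m) ≡ m
  length-allFin = length-tabulate {n = m} (λ i → i)

  -- For each of the n coordinates, exactly m vertices agree with u off it.
  ∑-ν : ∀ {n} (u : Vec (Fin m) n) → ∑ (vecs n) (ν u) ≡ n * m
  ∑-ν []                = refl
  ∑-ν {suc n} (x ∷ u) = begin
    ∑ (vecs (suc n)) (ν (x ∷ u))
      ≡⟨ ∑-vecs n (ν (x ∷ u)) ⟩
    ∑ (allFin m) (λ y → ∑ (vecs n) λ v → δ u v + ind (x Fin.≟ y) * ν u v)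
      ≡⟨ ∑-cong (allFin m) (λ y → ∑-+ (vecs n) (δ u) _) ⟩
    ∑ (allFin m) (λ y → ∑ (vecs n) (δ u) + ∑ (vecs n) (λ v → ind (x Fin.≟ y) * ν u v))
      ≡⟨ ∑-cong (allFin m) (λ y → cong₂ _+_
           (trans (∑-cong (vecs n) (λ v → sym (*-identityʳ (δ u v)))) (∑-δ u (λ _ → 1)))
           (trans (∑-*ˡ (vecs n) (ind (x Fin.≟ y)) (ν u)) (cong (ind (x Fin.≟ y) *_) (∑-ν u)))) ⟩
    ∑ (allFin m) (λ y → 1 + ind (x Fin.≟ y) * (n * m))
      ≡⟨ ∑-+ (allFin m) (λ _ → 1) _ ⟩
    ∑ (allFin m) (λ _ → 1) + ∑ (allFin m) (λ y → ind (x Fin.≟ y) * (n * m))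
      ≡⟨ cong₂ _+_
           (trans (∑-const (allFin m) 1) (trans (*-identityʳ _) length-allFin))
           (∑-delta-vertices (K m) x (λ _ → n * m)) ⟩
    m + n * m ∎
    where open ≡-Reasoning

  -- The quadratic form of `ν`. At the indicator of A it counts the triples (u, v, j) with u and v
  -- in A agreeing off coordinate j.
  Dν : ∀ n → (Vec (Fin m) n → ℕ) → ℕ
  Dν n f = ∑∑ (H n m) λ u v → f u * f v * ν u v

  -- The triples are split by the free coordinate. If it is a later one, the heads agree and the
  -- pair lies in one slice; if it is the first, the tails agree and the heads are arbitrary.
  Dν-suc : ∀ n f → Dν (suc n) f
         ≡ ∑ (allFin m) (λ x → Dν n (λ u → f (x ∷ u)))
           + ∑ (allFin m) (λ x → ∑ (allFin m) λ y → ∑ (vecs n) λ u → f (x ∷ u) * f (y ∷ u))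
  Dν-suc n f = begin
    Dν (suc n) f
      ≡⟨ ∑-vecs n _ ⟩
    ∑ F (λ x → ∑ (vecs n) λ u → ∑ (vecs (suc n)) λ w → f (x ∷ u) * f w * ν (x ∷ u) w)
      ≡⟨ ∑-cong F (λ x → ∑-cong (vecs n) λ u → trans (inner x u) (+-comm (cross x u) _)) ⟩
    ∑ F (λ x → ∑ (vecs n) λ u → within x u + cross x u)
      ≡⟨ trans (∑-cong F λ x → ∑-+ (vecs n) (within x) (cross x)) (∑-+ F _ _) ⟩
    ∑ F (λ x → ∑ (vecs n) (within x)) + ∑ F (λ x → ∑ (vecs n) (cross x))
      ≡⟨ cong (∑ F (λ x → ∑ (vecs n) (within x)) +_)
           (∑-cong F λ x → ∑-swap (vecs n) F (λ u y → f (x ∷ u) * f (y ∷ u))) ⟩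
    ∑ F (λ x → Dν n (λ u → f (x ∷ u)))
      + ∑ F (λ x → ∑ F λ y → ∑ (vecs n) λ u → f (x ∷ u) * f (y ∷ u)) ∎
    where
    open ≡-Reasoning
    F = allFin m
    within cross : Fin m → Vec (Fin m) n → ℕ
    within x u = ∑ (vecs n) λ v → f (x ∷ u) * f (x ∷ v) * ν u v
    cross  x u = ∑ F λ y → f (x ∷ u) * f (y ∷ u)
    eq₁ : ∀ a b d e k → a * b * (d + e * k) ≡ d * (a * b) + e * (a * b * k)
    eq₁ = solve-∀
    inner : ∀ x u → ∑ (vecs (suc n)) (λ w → f (x ∷ u) * f w * ν (x ∷ u) w) ≡ cross x u + within x u
    inner x u = begin
      ∑ (vecs (suc n)) (λ w → f (x ∷ u) * f w * ν (x ∷ u) w)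
        ≡⟨ ∑-vecs n _ ⟩
      ∑ F (λ y → ∑ (vecs n) λ v → f (x ∷ u) * f (y ∷ v) * (δ u v + ind (x Fin.≟ y) * ν u v))
        ≡⟨ ∑-cong F (λ y → trans
             (∑-cong (vecs n) λ v → eq₁ (f (x ∷ u)) (f (y ∷ v)) (δ u v) (ind (x Fin.≟ y)) (ν u v))
             (∑-+ (vecs n) _ _)) ⟩
      ∑ F (λ y → ∑ (vecs n) (λ v → δ u v * (f (x ∷ u) * f (y ∷ v)))
               + ∑ (vecs n) (λ v → ind (x Fin.≟ y) * (f (x ∷ u) * f (y ∷ v) * ν u v)))
        ≡⟨ ∑-cong F (λ y → cong₂ _+_ (∑-δ u (λ v → f (x ∷ u) * f (y ∷ v))) (∑-*ˡ (vecs n) (ind (x Fin.≟ y)) (λ v → f (x ∷ u) * f (y ∷ v) * ν u v))) ⟩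
      ∑ F (λ y → f (x ∷ u) * f (y ∷ u)
               + ind (x Fin.≟ y) * ∑ (vecs n) (λ v → f (x ∷ u) * f (y ∷ v) * ν u v))
        ≡⟨ ∑-+ F _ _ ⟩
      cross x u + ∑ F (λ y → ind (x Fin.≟ y) * ∑ (vecs n) (λ v → f (x ∷ u) * f (y ∷ v) * ν u v))
        ≡⟨ cong (cross x u +_)
             (∑-delta-vertices (K m) x (λ y → ∑ (vecs n) λ v → f (x ∷ u) * f (y ∷ v) * ν u v)) ⟩
      cross x u + within x u ∎

-- The edge-isoperimetric inequality in exponentiated form

-- Functions with values at most 1 are closed under passing to the slices `f ∘ (x ∷_)`. The
-- induction hypothesis, multiplied over the slices, leaves the product of the `a x ^ a x`, which
-- `min-sum-bound` absorbs together with the pairs of equal tails.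
Dν-bound : ∀ m n (f : Vec (Fin (suc m)) n → ℕ) → (∀ u → f u ≤ 1) →
  let S = ∑ (vecs n) f in suc m ^ Dν n f ≤ suc m ^ (n * S) * (S ^ S) ^ m
Dν-bound m zero f f≤1 = begin
  suc m ^ Dν 0 f             ≡⟨ cong (suc m ^_) (eq (f [])) ⟩
  1                          ≤⟨ m^n>0 (S ^ S) {{n^n≢0 S}} m ⟩
  (S ^ S) ^ m                ≡⟨ *-identityˡ _ ⟨
  1 * (S ^ S) ^ m            ∎
  where
  open ≤-Reasoning
  S = ∑ (vecs 0) f
  eq : ∀ a → a * a * 0 + 0 + 0 ≡ 0
  eq = solve-∀
Dν-bound m (suc n) f f≤1 = begin
  suc m ^ Dν (suc n) f
    ≡⟨ cong (suc m ^_) (Dν-suc n f) ⟩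
  suc m ^ (∑ F (λ x → Dν n (f ∘ (x ∷_))) + C)
    ≡⟨ ^-distribˡ-+-* (suc m) (∑ F (λ x → Dν n (f ∘ (x ∷_)))) C ⟩
  suc m ^ ∑ F (λ x → Dν n (f ∘ (x ∷_))) * suc m ^ C
    ≤⟨ *-mono-≤ slices (^-monoʳ-≤ (suc m) cross) ⟩
  suc m ^ (n * S) * P ^ m * suc m ^ min-sum F a
    ≡⟨ trans (*-assoc (suc m ^ (n * S)) (P ^ m) _) (cong (suc m ^ (n * S) *_) (*-comm (P ^ m) _)) ⟩
  suc m ^ (n * S) * (suc m ^ min-sum F a * P ^ m)
    -- Any common bound on the slice sizes will do for N; the number of all tails is one.
    ≤⟨ *-monoʳ-≤ (suc m ^ (n * S)) (min-sum-bound F m (≤-reflexive length-allFin)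
         (length (vecs n)) a (λ x → ∑-≤1 (vecs n) (λ u → f≤1 (x ∷ u)))) ⟩
  suc m ^ (n * S) * (suc m ^ S * (S ^ S) ^ m)
    ≡⟨ *-assoc (suc m ^ (n * S)) (suc m ^ S) _ ⟨
  suc m ^ (n * S) * suc m ^ S * (S ^ S) ^ m
    ≡⟨ cong (_* (S ^ S) ^ m) (trans (*-comm (suc m ^ (n * S)) _) (sym (^-distribˡ-+-* (suc m) S (n * S)))) ⟩
  suc m ^ (suc n * S) * (S ^ S) ^ m
    ≡⟨ cong (λ S → suc m ^ (suc n * S) * (S ^ S) ^ m) (∑-vecs n f) ⟨
  suc m ^ (suc n * ∑ (vecs (suc n)) f) * (∑ (vecs (suc n)) f ^ ∑ (vecs (suc n)) f) ^ m ∎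
  where
  open ≤-Reasoning
  F = allFin (suc m)
  a : Fin (suc m) → ℕ
  a x = ∑ (vecs n) (f ∘ (x ∷_))
  S = ∑ F a
  P = ∏ F (λ x → a x ^ a x)
  C = ∑ F λ x → ∑ F λ y → ∑ (vecs n) λ u → f (x ∷ u) * f (y ∷ u)
  -- A product of two values at most 1 is at most either of them, so each inner sum is at most both
  -- slice sizes.
  cross : C ≤ min-sum F a
  cross = ∑-mono F λ x → ∑-mono F λ y → ⊓-glb
    (∑-mono (vecs n) λ u → ≤-trans (*-monoʳ-≤ (f (x ∷ u)) (f≤1 (y ∷ u))) (≤-reflexive (*-identityʳ _)))
    (∑-mono (vecs n) λ u → ≤-trans (*-monoˡ-≤ (f (y ∷ u)) (f≤1 (x ∷ u))) (≤-reflexive (*-identityˡ _)))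
  slices : suc m ^ ∑ F (λ x → Dν n (f ∘ (x ∷_))) ≤ suc m ^ (n * S) * P ^ m
  slices = begin
    suc m ^ ∑ F (λ x → Dν n (f ∘ (x ∷_)))
      ≡⟨ ^-∏ F (suc m) (λ x → Dν n (f ∘ (x ∷_))) ⟩
    ∏ F (λ x → suc m ^ Dν n (f ∘ (x ∷_)))
      ≤⟨ ∏-mono F (λ x → Dν-bound m n (f ∘ (x ∷_)) (f≤1 ∘ (x ∷_))) ⟩
    ∏ F (λ x → suc m ^ (n * a x) * (a x ^ a x) ^ m)
      ≡⟨ ∏-* F (λ x → suc m ^ (n * a x)) (λ x → (a x ^ a x) ^ m) ⟩
    ∏ F (λ x → suc m ^ (n * a x)) * ∏ F (λ x → (a x ^ a x) ^ m)
      ≡⟨ cong₂ _*_ (sym (^-∏ F (suc m) (λ x → n * a x))) (∏-^ F (λ x → a x ^ a x) m) ⟩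
    suc m ^ ∑ F (λ x → n * a x) * P ^ m
      ≡⟨ cong (λ z → suc m ^ z * P ^ m) (∑-*ˡ F n a) ⟩
    suc m ^ (n * S) * P ^ m ∎

module _ {m n : ℕ} (A : Subset (H n m)) where
  private
    G = H n m
    f = bit ∘ A
    a = ∑ (vecs n) f

  -- Pairs are ordered, so this is twice the number of edges inside A.
  arcs : ℕ
  arcs = ∑∑ G λ u v → bit (A u) * bit (A v) * ind (Graph._~?_ G u v)

  Dν-arcs : Dν n (bit ∘ A) ≡ arcs + n * ∑ (vecs n) (bit ∘ A)
  Dν-arcs = begin
    ∑∑ G (λ u v → f u * f v * ν u v)
      ≡⟨ ∑∑-cong G (λ u v → trans (cong (f u * f v *_) (ν-split u v)) (eq (f u) (f v) (ind (Graph._~?_ G u v)) n (δ u v))) ⟩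
    ∑∑ G (λ u v → f u * f v * ind (Graph._~?_ G u v) + δ u v * (n * (f u * f v)))
      ≡⟨ ∑∑-+ G _ _ ⟩
    arcs + ∑∑ G (λ u v → δ u v * (n * (f u * f v)))
      ≡⟨ cong (arcs +_) (∑-cong (vecs n) λ u → trans (∑-δ u (λ v → n * (f u * f v))) (cong (n *_) (bit-idem (A u)))) ⟩
    arcs + ∑ (vecs n) (λ u → n * f u)
      ≡⟨ cong (arcs +_) (∑-*ˡ (vecs n) n f) ⟩
    arcs + n * a ∎
    where
    open ≡-Reasoning
    eq : ∀ x y e n d → x * y * (e + n * d) ≡ x * y * e + d * (n * (x * y))
    eq = solve-∀

  -- Double counting of the sum of `ν u v` over u in A and all v. The v outside A give the boundary,
  -- those inside give `Dν`, and each row sums to `n * m`.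
  boundary-+-Dν : boundary G A + Dν n (bit ∘ A) ≡ card G A * (n * m)
  boundary-+-Dν = begin
    boundary G A + Dν n f
      ≡⟨ cong (_+ Dν n f) (trans (boundary-∑∑ G A) (∑∑-cong G off-diagonal)) ⟩
    ∑∑ G (λ u v → f u * bit (not (A v)) * ν u v) + Dν n f
      ≡⟨ ∑∑-+ G _ _ ⟨
    ∑∑ G (λ u v → f u * bit (not (A v)) * ν u v + f u * f v * ν u v)
      ≡⟨ ∑∑-cong G (λ u v → trans (eq (f u) (bit (not (A v))) (f v) (ν u v)) (trans (cong (λ z → f u * (z * ν u v)) (bit-not-+ (A v))) (cong (f u *_) (*-identityˡ (ν u v))))) ⟩
    ∑∑ G (λ u v → f u * ν u v)
      ≡⟨ ∑-cong (vecs n) (λ u → trans (∑-*ˡ (vecs n) (f u) (ν u)) (cong (f u *_) (∑-ν u))) ⟩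
    ∑ (vecs n) (λ u → f u * (n * m))
      ≡⟨ ∑-*ʳ (vecs n) f (n * m) ⟩
    a * (n * m)
      ≡⟨ cong (_* (n * m)) (card-∑ G A) ⟨
    card G A * (n * m) ∎
    where
    open ≡-Reasoning
    eq : ∀ x y z k → x * y * k + x * z * k ≡ x * ((y + z) * k)
    eq = solve-∀
    -- On the diagonal `ν` is n instead of 0, but there the first two factors ask u to be both in A
    -- and outside it.
    off-diagonal : ∀ u v → f u * bit (not (A v)) * ind (Graph._~?_ G u v) ≡ f u * bit (not (A v)) * ν u v
    off-diagonal u v = helper (Graph._≟_ G u v)
      where
      helper : Dec (u ≡ v) → f u * bit (not (A v)) * ind (Graph._~?_ G u v) ≡ f u * bit (not (A v)) * ν u v
      helper (yes refl) = trans (cong (_* ind (Graph._~?_ G u u)) (bit-not-* (A u))) (sym (cong (_* ν u u) (bit-not-* (A u))))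
      helper (no u≢v) = cong (f u * bit (not (A v)) *_) (sym (trans (ν-split u v)
        (trans (cong (λ z → ind (Graph._~?_ G u v) + n * z) (δ-≢ u v u≢v))
          (trans (cong (ind (Graph._~?_ G u v) +_) (*-zeroʳ n)) (+-identityʳ _)))))

-- The inequality with logarithms exponentiated, so that it lives in ℕ; `m` is one less than the
-- order of the complete graph. It is `Dν-bound` with `Dν` traded for the boundary, and the common
-- factor `suc m ^ (n * a)` is the contribution of the diagonal.
edge-isoperimetry : ∀ {m n} (A : Subset (H n (suc m))) →
  let a = card (H n (suc m)) A in
  suc m ^ (a * m * n) ≤ suc m ^ boundary (H n (suc m)) A * a ^ (a * m)
edge-isoperimetry {m} {n} A = *-cancelˡ-≤ (suc m ^ (n * a)) {{m^n≢0 (suc m) (n * a)}} (begin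
  suc m ^ (n * a) * suc m ^ (a * m * n)    ≡⟨ ^-distribˡ-+-* (suc m) (n * a) (a * m * n) ⟨
  suc m ^ (n * a + a * m * n)              ≡⟨ cong (suc m ^_) (trans (eq₁ n a m) (sym (boundary-+-Dν A))) ⟩
  suc m ^ (e + Dν n (bit ∘ A))             ≡⟨ ^-distribˡ-+-* (suc m) e _ ⟩
  suc m ^ e * suc m ^ Dν n (bit ∘ A)       ≤⟨ *-monoʳ-≤ (suc m ^ e) (subst (λ S → suc m ^ Dν n (bit ∘ A) ≤ suc m ^ (n * S) * (S ^ S) ^ m)
                                                (sym (card-∑ (H n (suc m)) A)) (Dν-bound m n (bit ∘ A) (bit≤1 ∘ A))) ⟩
  suc m ^ e * (suc m ^ (n * a) * (a ^ a) ^ m) ≡⟨ eq₂ (suc m ^ e) (suc m ^ (n * a)) ((a ^ a) ^ m) ⟩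
  suc m ^ (n * a) * (suc m ^ e * (a ^ a) ^ m) ≡⟨ cong (λ z → suc m ^ (n * a) * (suc m ^ e * z)) (^-*-assoc a a m) ⟩
  suc m ^ (n * a) * (suc m ^ e * a ^ (a * m)) ∎)
  where
  open ≤-Reasoning
  a = card (H n (suc m)) A
  e = boundary (H n (suc m)) A
  eq₁ : ∀ n a m → n * a + a * m * n ≡ a * (n * suc m)
  eq₁ = solve-∀
  eq₂ : ∀ x y z → x * (y * z) ≡ y * (x * z)
  eq₂ = solve-∀

-- Subcubes

ind-⇔ : {P Q : Set} (P? : Dec P) (Q? : Dec Q) → P ⇔ Q → ind P? ≡ ind Q?
ind-⇔ P? (yes q) P⇔Q = ind-yes P? (Equivalence.from P⇔Q q)
ind-⇔ P? (no ¬q) P⇔Q = ind-no P? (¬q ∘ Equivalence.to P⇔Q)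

-- The image of one vertex list and the other vertex list are both free of repetitions and
-- exhaustive, hence permutations of each other.
∑-bijection : ∀ G G′ (φ : Graph.V G ↔ Graph.V G′) (f : Graph.V G′ → ℕ) →
              ∑ (Graph.vertices G) (f ∘ Inverse.to φ) ≡ ∑ (Graph.vertices G′) f
∑-bijection G G′ φ f = trans (cong sum (map-∘ (Graph.vertices G))) (sum-↭ (↭.map⁺ f images))
  where
  open Inverse φ
  to-injective : ∀ {x y} → to x ≡ to y → x ≡ y
  to-injective {x} {y} eq = trans (sym (strictlyInverseʳ x)) (trans (cong from eq) (strictlyInverseʳ y))
  images : map to (Graph.vertices G) ↭ Graph.vertices G′
  images = ∼bag⇒↭ (unique∧set⇒bag (Unique.map⁺ to-injective (Graph.unique G)) (Graph.unique G′)
    λ {y} → mk⇔ (λ _ → Graph.complete G′ y)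
      (λ _ → subst (_∈ map to (Graph.vertices G)) (strictlyInverseˡ y)
               (∈-map⁺ to (Graph.complete G (from y)))))

∑-restrict : {X : Set} (A : X → Bool) (xs : List X) (f : X → ℕ) →
             ∑ (restrict A xs) (f ∘ proj₁) ≡ ∑ xs (λ x → bit (A x) * f x)
∑-restrict A []       f = refl
∑-restrict A (x ∷ xs) f with T? (A x)
... | yes t = cong₂ _+_ (sym (trans (cong (_* f x) (bit-T t)) (*-identityˡ (f x)))) (∑-restrict A xs f)
... | no ¬t = trans (∑-restrict A xs f) (cong (_+ ∑ xs (λ x → bit (A x) * f x)) (sym (cong (_* f x) (bit-¬T ¬t))))

order : Graph → ℕ
order G = length (Graph.vertices G)

degree-sum : Graph → ℕ
degree-sum G = ∑∑ G λ u v → ind (Graph._~?_ G u v)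

order-∑ : ∀ G → order G ≡ ∑ (Graph.vertices G) (λ _ → 1)
order-∑ G = sym (trans (∑-const (Graph.vertices G) 1) (*-identityʳ _))

order-≅ : ∀ G G′ → G ≅ G′ → order G ≡ order G′
order-≅ G G′ iso = trans (order-∑ G) (trans (∑-bijection G G′ (_≅_.bijection iso) (λ _ → 1)) (sym (order-∑ G′)))

degree-sum-≅ : ∀ G G′ → G ≅ G′ → degree-sum G ≡ degree-sum G′
degree-sum-≅ G G′ iso = begin
  degree-sum G
    ≡⟨ ∑∑-cong G (λ u v → ind-⇔ (Graph._~?_ G u v) (Graph._~?_ G′ (to u) (to v)) (_≅_.adjacency iso u v)) ⟩
  ∑∑ G (λ u v → ind (Graph._~?_ G′ (to u) (to v)))
    ≡⟨ ∑-cong (Graph.vertices G) (λ u → ∑-bijection G G′ bijection (λ v → ind (Graph._~?_ G′ (to u) v))) ⟩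
  ∑ (Graph.vertices G) (λ u → ∑ (Graph.vertices G′) λ v → ind (Graph._~?_ G′ (to u) v))
    ≡⟨ ∑-bijection G G′ bijection (λ u → ∑ (Graph.vertices G′) λ v → ind (Graph._~?_ G′ u v)) ⟩
  degree-sum G′ ∎
  where
  open ≡-Reasoning
  open _≅_ iso using (bijection)
  open Inverse bijection using (to)

order-induced : ∀ G A → order (induced G A) ≡ card G A
order-induced G A = trans (order-∑ (induced G A)) (trans (∑-restrict A (Graph.vertices G) (λ _ → 1))
  (trans (∑-cong (Graph.vertices G) (λ v → *-identityʳ (bit (A v)))) (sym (card-∑ G A))))

degree-sum-induced : ∀ {m n} (A : Subset (H n m)) → degree-sum (induced (H n m) A) ≡ arcs A
degree-sum-induced {m} {n} A = begin
  degree-sum (induced G A)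
    ≡⟨ ∑-cong (restrict A vs) (λ p → ∑-restrict A vs (λ v → ind (Graph._~?_ G (proj₁ p) v))) ⟩
  ∑ (restrict A vs) (λ p → ∑ vs λ v → bit (A v) * ind (Graph._~?_ G (proj₁ p) v))
    ≡⟨ ∑-restrict A vs (λ u → ∑ vs λ v → bit (A v) * ind (Graph._~?_ G u v)) ⟩
  ∑ vs (λ u → bit (A u) * ∑ vs λ v → bit (A v) * ind (Graph._~?_ G u v))
    ≡⟨ ∑-cong vs (λ u → trans (sym (∑-*ˡ vs (bit (A u)) _)) (∑-cong vs λ v → sym (*-assoc (bit (A u)) _ _))) ⟩
  arcs A ∎
  where
  open ≡-Reasoning
  G = H n m
  vs = Graph.vertices G

order-H : ∀ t m → order (H t m) ≡ m ^ t
order-H zero    m = refl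
order-H (suc t) m = begin
  order (H (suc t) m)                                  ≡⟨ order-∑ (H (suc t) m) ⟩
  ∑ (vecs {m} (suc t)) (λ _ → 1)                           ≡⟨ ∑-vecs {m} t (λ _ → 1) ⟩
  ∑ (allFin m) (λ _ → ∑ (vecs {m} t) (λ _ → 1))        ≡⟨ ∑-const (allFin m) _ ⟩
  length (allFin m) * ∑ (vecs {m} t) (λ _ → 1)         ≡⟨ cong₂ _*_ (length-allFin {m}) (trans (sym (order-∑ (H t m))) (order-H t m)) ⟩
  m * m ^ t                                            ∎
  where open ≡-Reasoning

-- Regularity of degree t (m - 1), with the subtracted term moved to the left. It is the row sum of
-- `ν`, whose diagonal accounts for that term.
degree-sum-H : ∀ t m → degree-sum (H t m) + order (H t m) * t ≡ order (H t m) * (t * m)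
degree-sum-H t m = begin
  degree-sum (H t m) + order (H t m) * t
    ≡⟨ cong (degree-sum (H t m) +_) (∑-const vs t) ⟨
  degree-sum (H t m) + ∑ vs (λ _ → t)
    ≡⟨ ∑-+ vs _ _ ⟨
  ∑ vs (λ u → ∑ vs (λ v → ind (Graph._~?_ (H t m) u v)) + t)
    ≡⟨ ∑-cong vs degree ⟩
  ∑ vs (λ _ → t * m)
    ≡⟨ ∑-const vs (t * m) ⟩
  order (H t m) * (t * m) ∎
  where
  open ≡-Reasoning
  vs = Graph.vertices (H t m)
  degree : ∀ u → ∑ vs (λ v → ind (Graph._~?_ (H t m) u v)) + t ≡ t * m
  degree u = begin
    ∑ vs (λ v → ind (Graph._~?_ (H t m) u v)) + t
      ≡⟨ cong (∑ vs (λ v → ind (Graph._~?_ (H t m) u v)) +_) (∑-δ u (λ _ → t)) ⟨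
    ∑ vs (λ v → ind (Graph._~?_ (H t m) u v)) + ∑ vs (λ v → δ u v * t)
      ≡⟨ ∑-+ vs _ _ ⟨
    ∑ vs (λ v → ind (Graph._~?_ (H t m) u v) + δ u v * t)
      ≡⟨ ∑-cong vs (λ v → trans (cong (ind (Graph._~?_ (H t m) u v) +_) (*-comm (δ u v) t)) (sym (ν-split u v))) ⟩
    ∑ vs (ν u)
      ≡⟨ ∑-ν u ⟩
    t * m ∎

-- A vertex has degree `m * n` in the ambient graph and, by the isomorphism, the degrees inside A
-- total `a * m * t`; the boundary is the rest. The summands `a * t` and `n * a` added in the proof
-- are the diagonals of `ν` on the subcube and on A.
boundary-subcube : ∀ {m n t} (A : Subset (H n (suc m))) → induced (H n (suc m)) A ≅ H t (suc m) →
  let a = card (H n (suc m)) A in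
  boundary (H n (suc m)) A + a * m * t ≡ a * m * n
boundary-subcube {m} {n} {t} A iso = +-cancelʳ-≡ (a * t + n * a) _ _ (begin
  e + a * m * t + (a * t + n * a)  ≡⟨ eq₁ e a m t n ⟩
  e + (a * (t * suc m) + n * a)    ≡⟨ cong (λ z → e + (z + n * a)) arcs≡ ⟨
  e + (arcs A + a * t + n * a)     ≡⟨ eq₂ e (arcs A) (a * t) (n * a) ⟩
  e + (arcs A + n * a) + a * t     ≡⟨ cong (λ z → e + (arcs A + n * z) + a * t) (card-∑ G A) ⟩
  e + (arcs A + n * ∑ (Graph.vertices G) (bit ∘ A)) + a * t
                                   ≡⟨ cong (λ z → e + z + a * t) (Dν-arcs A) ⟨
  e + Dν n (bit ∘ A) + a * t       ≡⟨ cong (_+ a * t) (boundary-+-Dν A) ⟩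
  a * (n * suc m) + a * t          ≡⟨ eq₃ a m t n ⟩
  a * m * n + (a * t + n * a)      ∎)
  where
  open ≡-Reasoning
  G = H n (suc m)
  a = card G A
  e = boundary G A
  order≡ : order (H t (suc m)) ≡ a
  order≡ = trans (sym (order-≅ (induced G A) (H t (suc m)) iso)) (order-induced G A)
  arcs≡ : arcs A + a * t ≡ a * (t * suc m)
  arcs≡ = subst₂ (λ d o → d + o * t ≡ o * (t * suc m))
    (trans (sym (degree-sum-≅ (induced G A) (H t (suc m)) iso)) (degree-sum-induced A)) order≡
    (degree-sum-H t (suc m))
  eq₁ : ∀ e a m t n → e + a * m * t + (a * t + n * a) ≡ e + (a * (t * suc m) + n * a)
  eq₁ = solve-∀
  eq₂ : ∀ e d x y → e + (d + x + y) ≡ e + (d + y) + x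
  eq₂ = solve-∀
  eq₃ : ∀ a m t n → a * (n * suc m) + a * t ≡ a * m * n + (a * t + n * a)
  eq₃ = solve-∀

card-subcube : ∀ {m n t} (A : Subset (H n m)) → induced (H n m) A ≅ H t m → card (H n m) A ≡ m ^ t
card-subcube {m} {n} {t} A iso = trans (sym (order-induced (H n m) A))
  (trans (order-≅ (induced (H n m) A) (H t m) iso) (order-H t m))

-- The real-valued bound

module _ {m n a : ℕ} (2≤ : 2 ≤ suc m) (1≤a : 1 ≤ a) where
  private
    L = log (suc m) a 2≤ 1≤a
    q = a * m

  bound : ℝ
  bound = fromℕ a *ᵣ (fromℕ (suc m) -ᵣ fromℕ 1) *ᵣ (fromℕ n -ᵣ L)

  -- All sequences but that of the logarithm are constant, so the bound is q n - q log a term by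
  -- term. What remains is to compare q log a with natural numbers.
  seq-bound : ∀ i → seq bound i ≡ frac (q * n) 0 ℚ.- frac q 0 ℚ.* seq L i
  seq-bound i = begin
    frac a 0 ℚ.* (frac (suc m) 0 ℚ.- frac 1 0) ℚ.* (frac n 0 ℚ.- seq L i)
      ≡⟨ cong (λ z → frac a 0 ℚ.* (z ℚ.- frac 1 0) ℚ.* (frac n 0 ℚ.- seq L i)) (frac-+ 1 m 0) ⟩
    frac a 0 ℚ.* (frac 1 0 ℚ.+ frac m 0 ℚ.- frac 1 0) ℚ.* (frac n 0 ℚ.- seq L i)
      ≡⟨ solve 5 (λ a o m n l → a :* (o :+ m :- o) :* (n :- l) := a :* m :* n :- a :* m :* l) refl
           (frac a 0) (frac 1 0) (frac m 0) (frac n 0) (seq L i) ⟩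
    frac a 0 ℚ.* frac m 0 ℚ.* frac n 0 ℚ.- frac a 0 ℚ.* frac m 0 ℚ.* seq L i
      ≡⟨ cong (λ z → z ℚ.* frac n 0 ℚ.- z ℚ.* seq L i) (frac-* a m 0) ⟨
    frac q 0 ℚ.* frac n 0 ℚ.- frac q 0 ℚ.* seq L i
      ≡⟨ cong (λ z → z ℚ.- frac q 0 ℚ.* seq L i) (frac-* q n 0) ⟨
    frac (q * n) 0 ℚ.- frac q 0 ℚ.* seq L i ∎
    where
    open ≡-Reasoning
    open +-*-Solver

  -- The hypothesis on powers says p ≤ q log a, whence q n - q log a ≤ q n - p ≤ e.
  bound-≤ : ∀ {e} p → q * n ≤ p + e → suc m ^ p ≤ a ^ q → bound ≤ᵣ fromℕ e
  bound-≤ {e} p qn≤p+e m^p≤a^q ε 0<ε with log-lower 2≤ 1≤a p q m^p≤a^q ε 0<ε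
  ... | N , close = N , λ i N≤i → let l = frac q 0 ℚ.* seq L i in begin-strict
    seq bound i                              ≡⟨ seq-bound i ⟩
    frac (q * n) 0 ℚ.- l                     ≤⟨ ℚ.+-monoˡ-≤ (ℚ.- l) (frac-≤ (q * n) 0 (p + e) 0 (*-monoˡ-≤ 1 qn≤p+e)) ⟩
    frac (p + e) 0 ℚ.- l                     ≡⟨ cong (ℚ._- l) (frac-+ p e 0) ⟩
    frac p 0 ℚ.+ frac e 0 ℚ.- l              ≡⟨ solve 3 (λ p e l → p :+ e :- l := p :+ (e :- l)) refl (frac p 0) (frac e 0) l ⟩
    frac p 0 ℚ.+ (frac e 0 ℚ.- l)            <⟨ ℚ.+-monoˡ-< (frac e 0 ℚ.- l) (close i N≤i) ⟩
    l ℚ.+ ε ℚ.+ (frac e 0 ℚ.- l)             ≡⟨ solve 3 (λ e l ε → l :+ ε :+ (e :- l) := e :+ ε) refl (frac e 0) l ε ⟩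
    frac e 0 ℚ.+ ε                           ∎
    where
    open ℚ.≤-Reasoning
    open +-*-Solver

  -- Dually, q log a ≤ p gives e ≤ q n - p ≤ q n - q log a.
  bound-≥ : ∀ {e} p → p + e ≤ q * n → a ^ q ≤ suc m ^ p → fromℕ e ≤ᵣ bound
  bound-≥ {e} p p+e≤qn a^q≤m^p ε 0<ε with log-upper 2≤ 1≤a p q a^q≤m^p ε 0<ε
  ... | N , close = N , λ i N≤i → let l = frac q 0 ℚ.* seq L i in begin-strict
    frac e 0                                 ≡⟨ solve 2 (λ e l → e := l :+ (e :- l)) refl (frac e 0) l ⟩
    l ℚ.+ (frac e 0 ℚ.- l)                   <⟨ ℚ.+-monoˡ-< (frac e 0 ℚ.- l) (close i N≤i) ⟩
    frac p 0 ℚ.+ ε ℚ.+ (frac e 0 ℚ.- l)      ≡⟨ solve 4 (λ p e l ε → p :+ ε :+ (e :- l) := p :+ e :- l :+ ε) refl (frac p 0) (frac e 0) l ε ⟩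
    frac p 0 ℚ.+ frac e 0 ℚ.- l ℚ.+ ε        ≡⟨ cong (λ z → z ℚ.- l ℚ.+ ε) (frac-+ p e 0) ⟨
    frac (p + e) 0 ℚ.- l ℚ.+ ε               ≤⟨ ℚ.+-monoˡ-≤ ε (ℚ.+-monoˡ-≤ (ℚ.- l) (frac-≤ (p + e) 0 (q * n) 0 (*-monoˡ-≤ 1 p+e≤qn))) ⟩
    frac (q * n) 0 ℚ.- l ℚ.+ ε               ≡⟨ cong (ℚ._+ ε) (seq-bound i) ⟨
    seq bound i ℚ.+ ε                        ∎
    where
    open ℚ.≤-Reasoning
    open +-*-Solver

≤ᵣ-antisym : ∀ x y → x ≤ᵣ y → y ≤ᵣ x → x ≃ᵣ y
≤ᵣ-antisym x y x≤y y≤x ε 0<ε with x≤y ε 0<ε | y≤x ε 0<ε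
... | M , f | N , g = M ⊔ N , λ i M⊔N≤i → ∣-∣-< (seq x i) (seq y i)
  (f i (m⊔n≤o⇒m≤o M N M⊔N≤i)) (g i (m⊔n≤o⇒n≤o M N M⊔N≤i))

mainTheorem7 : (m n : ℕ) (m≥2 : 2 ≤ m) (n≥1 : 1 ≤ n)
    (A : Subset (H n m)) (A≠∅ : Nonempty (H n m) A) →
    let
      ∣A∣  = card (H n m) A
      e    = boundary (H n m) A
      rhs  = fromℕ ∣A∣ *ᵣ (fromℕ m -ᵣ fromℕ 1) *ᵣ (fromℕ n -ᵣ log m ∣A∣ m≥2 (card>0 (H n m) A A≠∅))
    in
    (fromℕ e ≥ᵣ rhs)
    × ((t : ℕ) → 1 ≤ t → t ≤ n → induced (H n m) A ≅ H t m → fromℕ e ≃ᵣ rhs)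
mainTheorem7 (suc m) n m≥2 n≥1 A A≠∅ =
  -- The exponent is the least p with q n ≤ p + e; the subtraction is truncated at 0.
  bound-≤ {m} {n} m≥2 1≤a (q * n ∸ e) (≤-trans (m≤n+m∸n (q * n) e) (≤-reflexive (+-comm e (q * n ∸ e)))) slack ,
  -- For a subcube a = (m + 1) ^ t, so q log a is exactly q t, and p = q t serves for both
  -- directions.
  λ t _ _ iso → let
      e+qt≡qn = boundary-subcube A iso
      a^q≡    = trans (cong (_^ q) (card-subcube A iso)) (trans (^-*-assoc (suc m) t q) (cong (suc m ^_) (*-comm t q)))
      qt+e≡qn = trans (+-comm (q * t) e) e+qt≡qn
    in ≤ᵣ-antisym (fromℕ e) (bound {m} {n} m≥2 1≤a)
         (bound-≥ {m} {n} m≥2 1≤a (q * t) (≤-reflexive qt+e≡qn) (≤-reflexive a^q≡))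
         (bound-≤ {m} {n} m≥2 1≤a (q * t) (≤-reflexive (sym qt+e≡qn)) (≤-reflexive (sym a^q≡)))
  where
  a = card (H n (suc m)) A
  e = boundary (H n (suc m)) A
  q = a * m
  1≤a = card>0 (H n (suc m)) A A≠∅
  -- If e ≤ q n, this is `edge-isoperimetry` with `suc m ^ e` cancelled. Otherwise the exponent is 0
  -- and the claim is 1 ≤ a ^ q.
  slack : suc m ^ (q * n ∸ e) ≤ a ^ q
  slack with ≤-total e (q * n)
  ... | inj₁ e≤qn = *-cancelˡ-≤ (suc m ^ e) {{m^n≢0 (suc m) e}} (begin
      suc m ^ e * suc m ^ (q * n ∸ e)  ≡⟨ ^-distribˡ-+-* (suc m) e (q * n ∸ e) ⟨
      suc m ^ (e + (q * n ∸ e))        ≡⟨ cong (suc m ^_) (m+[n∸m]≡n e≤qn) ⟩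
      suc m ^ (q * n)                  ≤⟨ edge-isoperimetry A ⟩
      suc m ^ e * a ^ q                ∎)
    where open ≤-Reasoning
  ... | inj₂ qn≤e rewrite m≤n⇒m∸n≡0 qn≤e = pow>0 q 1≤a
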